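{- Let $H$ be the graph on vertex set $\{0,1,2,3\}$ with red edge set $\{\{0,1\},\{1,2\}\}$ and blue edge set $\{\{0,2\},\{0,3\}\}$. Then $\lambda_H=1/8$, the semi-inducibility problem for $H$ is perfectly $K_2$-stable, and the unique maximizer of $\lambda_H(K_2(\mathbf a))$ over vectors $\mathbf a$ of two non-negative reals summing to $1$ is $\mathbf a=(1/2,1/2)$.
   Context: All graphs are finite and simple; the order of a graph is its number of vertices. For a graph $H$ with $\kappa$ vertices whose edges are coloured red or blue and an uncoloured graph $G$ of order $n\ge\kappa$, an embedding of $H$ into $G$ is an injection $V(H)\to V(G)$ that maps red edges of $H$ to edges of $G$ and blue edges of $H$ to non-edges of $G$ (pairs of distinct non-adjacent vertices). $\Lambda_H(G)$ is the number of embeddings, $\lambda_H(G):=\Lambda_H(G)/\big(n(n-1)\cdots(n-\kappa+1)\big)$, $\lambda_H(n)$ is the maximum of $\lambda_H(G)$ over all graphs $G$ of order $n$, and $\lambda_H:=\lim_{n\to\infty}\lambda_H(n)$ (the limit exists). For a graph $B$ on $\{0,\dots,m-1\}$ and pairwise disjoint finite sets $V_0,\dots,V_{m-1}$ (some possibly empty), the blowup $B(V_0,\dots,V_{m-1})$ is the graph on $\bigcup_i V_i$ in which $x\in V_i$ and $y\in V_j$ are adjacent if and only if $\{i,j\}\in E(B)$. For a vector $\mathbf a=(a_0,\dots,a_{m-1})$ of non-negative reals summing to $1$, $\lambda_H(B(\mathbf a))$ denotes the limit as $n\to\infty$ of $\lambda_H(B(V_0,\dots,V_{m-1}))$ where $\sum_i|V_i|=n$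 and $|V_i|=(a_i+o(1))n$. Equivalently, it is $\sum_f\prod_{i\in V(H)}a_{f(i)}$, the sum being over all maps $f:V(H)\to V(B)$ sending every red edge of $H$ to an edge of $B$ and every blue edge to a non-edge of $B$ or to two equal vertices. The edit distance $\delta_{\mathrm{edit}}(G,G')$ between two graphs of the same order is the minimum of $|f(E(G))\bigtriangleup E(G')|$ over all bijections $f:V(G)\to V(G')$. The semi-inducibility problem for $H$ is perfectly $B$-stable if there is $C>0$ such that for every graph $G$ of order $n\ge C$ there is a blowup $G'$ of $B$ of order $n$ with $\delta_{\mathrm{edit}}(G,G')\le C\,(\lambda_H(n)-\lambda_H(G))\,n^2$. (Here $C\ge\kappa$ may be assumed.) -}

module Defs where

open import Data.Bool.Base using (Bool; true; false; T; not; _∧_; _∨_; _xor_)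
open import Data.Bool.Properties using (T?; ∨-comm; ∨-idem)
open import Data.Fin.Base using (Fin)
open import Data.Fin.Patterns using (0F; 1F; 2F; 3F)
import Data.Fin.Base as Fin
import Data.Fin.Properties as Fin
open import Data.Fin.Permutation using (Permutation′; permutation; _⟨$⟩ʳ_; _⟨$⟩ˡ_; inverseˡ; inverseʳ)
import Data.Fin.Permutation as Perm
open import Data.Integer.Base using (+_)
open import Data.List.Base using (List; []; _∷_; length; filter; map; mapMaybe; allFin; cartesianProduct; cartesianProductWith)
open import Data.List.Membership.Propositional using (_∈_; lose)
open import Data.List.Membership.Propositional.Properties
  using (∈-map⁺; ∈-allFin; ∈-cartesianProduct⁺; ∈-cartesianProductWith⁺)
open import Data.List.Properties using (filter-≐)
open import Data.List.Relation.Unary.Any using (here; there)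
import Data.List.Extrema as Extrema
import Data.List.Relation.Unary.Any as Any
import Data.List.Relation.Unary.Any.Properties as Any
open import Data.Maybe.Base renaming (map to mapᴹ)
  using (Maybe)
import Data.Maybe.Relation.Unary.Any as Maybe
open import Data.Nat.Base using (ℕ; zero; suc; _≤_; _⊔_; _∸_; NonZero; >-nonZero)
open import Data.Nat.Combinatorics using (_P_; nPk≡n!/[n∸k]!)
import Data.Nat.DivMod as ℕ
open import Data.Nat.Divisibility using (∣⇒≤; m≤n⇒m!∣n!)
import Data.Nat.Properties as ℕ
open import Data.Product using (Σ-syntax; ∃-syntax; _×_; _,_)
open import Data.Sum.Base using (inj₂)
open import Data.Product.Properties using (≡-dec)
open import Data.Rational.Base as ℚ using (ℚ; 0ℚ; 1ℚ; ½; _/_)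
import Data.Rational.Properties as ℚ
open import Data.Rational.Solver using (module +-*-Solver)
open import Data.Vec.Base using (Vec; []; _∷_; lookup; tabulate)
open import Data.Vec.Properties using (lookup∘tabulate)
import Data.Vec.Functional as Vector
open import Function.Base using (_∘_)
open import Function.Definitions using (Injective; StrictlyInverseˡ; StrictlyInverseʳ)
open import Relation.Binary.Bundles using (DecTotalOrder)
open import Relation.Binary.PropositionalEquality
open import Relation.Nullary using (¬_; Dec; yes; no; does; contradiction)
open import Relation.Nullary.Decidable using (map′; _×-dec_; _→-dec_; ¬?; dec⇒maybe)

import Data.List.Membership.DecPropositional as DecMembership

private
  variable
    k m n κ : ℕ

record Graph (n : ℕ) : Set where
  field
    adj     : Fin n → Fin n → Bool
    adj-sym : ∀ x y → adj x y ≡ adj y x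
    adj-irr : ∀ x → adj x x ≡ false

open Graph public

-- The graph whose edges are the pairs of distinct x, y related by R in at
-- least one direction.

graphOf : (Fin n → Fin n → Bool) → Graph n
graphOf R .adj x y = not (does (x Fin.≟ y)) ∧ (R x y ∨ R y x)
graphOf R .adj-sym x y with x Fin.≟ y | y Fin.≟ x
... | yes _   | yes _   = refl
... | yes x≡y | no  y≢x = contradiction (sym x≡y) y≢x
... | no  x≢y | yes y≡x = contradiction (sym y≡x) x≢y
... | no  _   | no  _   = ∨-comm (R x y) (R y x)
graphOf R .adj-irr x with x Fin.≟ x
... | yes _   = refl
... | no  x≢x = contradiction refl x≢x

fromEdges : List (Fin n × Fin n) → Graph n
fromEdges es = graphOf (λ x y → does ((x , y) ∈? es))
  where open DecMembership (≡-dec Fin._≟_ Fin._≟_) using (_∈?_)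

complete : ∀ m → Graph m
complete m = graphOf (λ _ _ → true)

record ColouredGraph (κ : ℕ) : Set where
  field
    red blue : Graph κ
    disjoint : ∀ i j → T (adj red i j) → ¬ T (adj blue i j)

open ColouredGraph public

record IsEmbedding (H : ColouredGraph κ) (G : Graph n) (f : Fin κ → Fin n) : Set where
  constructor mkIsEmbedding
  field
    injective : Injective _≡_ _≡_ f
    red⇒edge  : ∀ i j → T (adj (red H) i j) → T (adj G (f i) (f j))
    blue⇒non  : ∀ i j → T (adj (blue H) i j) → ¬ T (adj G (f i) (f j))

isEmbedding? : (H : ColouredGraph κ) (G : Graph n) (f : Fin κ → Fin n) → Dec (IsEmbedding H G f)
isEmbedding? H G f = map′
  (λ (inj , r , b) → mkIsEmbedding (λ {i} {j} → inj i j) r b)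
  (λ e → let open IsEmbedding e in (λ _ _ → injective) , red⇒edge , blue⇒non)
  (    Fin.all? (λ i → Fin.all? λ j → (f i Fin.≟ f j) →-dec (i Fin.≟ j))
  ×-dec Fin.all? (λ i → Fin.all? λ j → T? _ →-dec T? _)
  ×-dec Fin.all? (λ i → Fin.all? λ j → T? _ →-dec ¬? (T? _)))

vectors : {A : Set} → List A → ∀ k → List (Vec A k)
vectors xs zero    = [] ∷ []
vectors xs (suc k) = cartesianProductWith _∷_ xs (vectors xs k)

∈-vectors : {A : Set} {xs : List A} → (∀ x → x ∈ xs) → (v : Vec A k) → v ∈ vectors xs k
∈-vectors all []      = here refl
∈-vectors all (x ∷ v) = ∈-cartesianProductWith⁺ _∷_ (all x) (∈-vectors all v)

-- A map Fin κ → Fin n is represented by its vector of values, and each vector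
-- is listed exactly once, so Λ counts every embedding once.

Λ : ColouredGraph κ → Graph n → ℕ
Λ {κ} {n} H G = length (filter (λ v → isEmbedding? H G (lookup v)) (vectors (allFin n) κ))

-- n P k = n (n − 1) ⋯ (n − k + 1)

nPk≢0 : k ≤ n → NonZero (n P k)
nPk≢0 {k} {n} k≤n = subst NonZero (sym (nPk≡n!/[n∸k]! k≤n))
  (>-nonZero (ℕ.m≥n⇒m/n>0 (∣⇒≤ {{n ℕ.!≢0}} (m≤n⇒m!∣n! (ℕ.m∸n≤m n k)))))
  where instance _ = (n ∸ k) ℕ.!≢0

density : ColouredGraph κ → Graph n → .(κ ≤ n) → ℚ
density {κ} {n} H G κ≤n = _/_ (+ Λ H G) (n P κ) {{nPk≢0 κ≤n}}

-- Every graph on Fin n occurs here up to pointwise equality of adjacency.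

graphs : ∀ n → List (Graph n)
graphs n = map (λ M → graphOf λ x y → lookup (lookup M x) y)
               (vectors (vectors (true ∷ false ∷ []) n) n)

module ℚ-Extrema = Extrema (DecTotalOrder.totalOrder ℚ.≤-decTotalOrder)
module ℕ-Extrema = Extrema ℕ.≤-totalOrder

maxDensity : ColouredGraph κ → ∀ n → .(κ ≤ n) → ℚ
maxDensity H n κ≤n =
  density H (ℚ-Extrema.argmax (λ G → density H G κ≤n) (complete n) (graphs n)) κ≤n

-- Blowups: a partition of Fin n into m possibly empty parts V₀, …, Vₘ₋₁ is
-- given by the map sending each vertex to the index of its part.

blowup : Graph m → (Fin n → Fin m) → Graph n
blowup B c .adj x y     = adj B (c x) (c y)
blowup B c .adj-sym x y = adj-sym B (c x) (c y)
blowup B c .adj-irr x   = adj-irr B (c x)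

partSize : (Fin n → Fin m) → Fin m → ℕ
partSize {n} c i = length (filter (λ x → c x Fin.≟ i) (allFin n))

partFraction : (Fin n → Fin m) → Fin m → .(1 ≤ n) → ℚ
partFraction {n} c i 1≤n = _/_ (+ partSize c i) n {{>-nonZero 1≤n}}

image : Permutation′ n → Graph n → Graph n
image π G .adj x y     = adj G (π ⟨$⟩ˡ x) (π ⟨$⟩ˡ y)
image π G .adj-sym x y = adj-sym G (π ⟨$⟩ˡ x) (π ⟨$⟩ˡ y)
image π G .adj-irr x   = adj-irr G (π ⟨$⟩ˡ x)

-- An edge is a pair with x < y.

∣E_△E_∣ : Graph n → Graph n → ℕ
∣E_△E_∣ {n} G G′ = length
  (filter (λ (x , y) → (x Fin.<? y) ×-dec T? (adj G x y xor adj G′ x y))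
          (cartesianProduct (allFin n) (allFin n)))

-- Every permutation of Fin n occurs here up to pointwise equality.

toPermutation : Vec (Fin n) n × Vec (Fin n) n → Maybe (Permutation′ n)
toPermutation (v , w) = mapᴹ
  (λ (invˡ , invʳ) → permutation (lookup v) (lookup w) invˡ invʳ)
  (dec⇒maybe (Fin.all? (λ x → lookup v (lookup w x) Fin.≟ x)
        ×-dec Fin.all? (λ x → lookup w (lookup v x) Fin.≟ x)))

permutations : ∀ n → List (Permutation′ n)
permutations n = mapMaybe toPermutation
  (cartesianProduct (vectors (allFin n) n) (vectors (allFin n) n))

editDistance : Graph n → Graph n → ℕ
editDistance {n} G G′ =
  ∣E image (ℕ-Extrema.argmin (λ π → ∣E image π G △E G′ ∣) Perm.id (permutations n)) G △E G′ ∣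

-- A rational C suffices: any larger constant also works, since the bound is
-- non-negative.

perfectlyStable : ColouredGraph κ → Graph m → Set
perfectlyStable {κ} {m} H B =
  Σ[ C ∈ ℚ ] 0ℚ ℚ.< C ×
    (∀ n .(κ≤n : κ ≤ n) → C ℚ.≤ + n / 1 → (G : Graph n) →
      Σ[ c ∈ (Fin n → Fin m) ]
        + editDistance G (blowup B c) / 1
          ℚ.≤ C ℚ.* (maxDensity H n κ≤n ℚ.- density H G κ≤n) ℚ.* (+ n / 1 ℚ.* (+ n / 1)))

-- Real numbers, as Cauchy sequences of rationals with the setoid equality _≈_.

record ℝ : Set where
  field
    approx : ℕ → ℚ
    cauchy : ∀ ε → 0ℚ ℚ.< ε →
             ∃[ N ] (∀ i j → N ≤ i → N ≤ j → ℚ.∣ approx i ℚ.- approx j ∣ ℚ.< ε)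

open ℝ public

infix  4 _≤ᴿ_ _≈_
infixl 6 _+ᴿ_

_≤ᴿ_ : ℝ → ℝ → Set
x ≤ᴿ y = ∀ ε → 0ℚ ℚ.< ε → ∃[ N ] (∀ i → N ≤ i → approx x i ℚ.≤ approx y i ℚ.+ ε)

_≈_ : ℝ → ℝ → Set
x ≈ y = x ≤ᴿ y × y ≤ᴿ x

fromℚ : ℚ → ℝ
fromℚ q .approx _ = q
fromℚ q .cauchy ε ε>0 = 0 , λ _ _ _ _ →
  subst (ℚ._< ε) (sym (cong ℚ.∣_∣ (ℚ.+-inverseʳ q))) ε>0

_+ᴿ_ : ℝ → ℝ → ℝ
(x +ᴿ y) .approx i = approx x i ℚ.+ approx y i
(x +ᴿ y) .cauchy ε ε>0 =
  let ½ε>0   = subst (ℚ._< ½ ℚ.* ε) (ℚ.*-zeroʳ ½) (ℚ.*-monoʳ-<-pos ½ ε>0)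
      N , hx = cauchy x (½ ℚ.* ε) ½ε>0
      M , hy = cauchy y (½ ℚ.* ε) ½ε>0
  in N ⊔ M , λ i j i≥ j≥ →
    bound (approx x i) (approx x j) (approx y i) (approx y j)
      (hx i j (ℕ.≤-trans (ℕ.m≤m⊔n N M) i≥) (ℕ.≤-trans (ℕ.m≤m⊔n N M) j≥))
      (hy i j (ℕ.≤-trans (ℕ.m≤n⊔m N M) i≥) (ℕ.≤-trans (ℕ.m≤n⊔m N M) j≥))
  where
  open +-*-Solver

  rearrange : ∀ a b c d → (a ℚ.+ c) ℚ.- (b ℚ.+ d) ≡ (a ℚ.- b) ℚ.+ (c ℚ.- d)
  rearrange = solve 4 (λ a b c d → (a :+ c) :- (b :+ d) := (a :- b) :+ (c :- d)) refl

  halves : ½ ℚ.* ε ℚ.+ ½ ℚ.* ε ≡ ε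
  halves = trans (sym (ℚ.*-distribʳ-+ ε ½ ½)) (ℚ.*-identityˡ ε)

  bound : ∀ a b c d → ℚ.∣ a ℚ.- b ∣ ℚ.< ½ ℚ.* ε → ℚ.∣ c ℚ.- d ∣ ℚ.< ½ ℚ.* ε →
          ℚ.∣ (a ℚ.+ c) ℚ.- (b ℚ.+ d) ∣ ℚ.< ε
  bound a b c d p q = begin-strict
    ℚ.∣ (a ℚ.+ c) ℚ.- (b ℚ.+ d) ∣           ≡⟨ cong ℚ.∣_∣ (rearrange a b c d) ⟩
    ℚ.∣ (a ℚ.- b) ℚ.+ (c ℚ.- d) ∣           ≤⟨ ℚ.∣p+q∣≤∣p∣+∣q∣ (a ℚ.- b) (c ℚ.- d) ⟩
    ℚ.∣ a ℚ.- b ∣ ℚ.+ ℚ.∣ c ℚ.- d ∣         <⟨ ℚ.+-mono-< p q ⟩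
    ½ ℚ.* ε ℚ.+ ½ ℚ.* ε                     ≡⟨ halves ⟩
    ε                                       ∎
    where open ℚ.≤-Reasoning

∑ : (Fin m → ℝ) → ℝ
∑ = Vector.foldr _+ᴿ_ (fromℚ 0ℚ)

-- Rational sequences indexed by the n ≥ k, and the limit of one as n → ∞.

SequenceFrom : ℕ → Set
SequenceFrom k = ∀ n → .(k ≤ n) → ℚ

infix 4 _⟶_

_⟶_ : SequenceFrom k → ℝ → Set
_⟶_ {k} q x = ∀ ε → 0ℚ ℚ.< ε → ∃[ N ] (∀ n .(k≤n : k ≤ n) → N ≤ n →
  fromℚ (q n k≤n) ≤ᴿ x +ᴿ fromℚ ε × x ≤ᴿ fromℚ (q n k≤n) +ᴿ fromℚ ε)

record Simplex (m : ℕ) : Set where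
  field
    coord  : Fin m → ℝ
    nonneg : ∀ i → fromℚ 0ℚ ≤ᴿ coord i
    sum≈1  : ∑ coord ≈ fromℚ 1ℚ

open Simplex public

-- x is the common limit of λ_H(B(V₀, …, Vₘ₋₁)) along all sequences of
-- partitions of Fin n with |Vᵢ| = (aᵢ + o(1)) n.

IsBlowupDensity : ColouredGraph κ → Graph m → Simplex m → ℝ → Set
IsBlowupDensity {κ} {m} H B a x =
  (c : ∀ n → Fin n → Fin m) →
  (∀ i → (λ n 1≤n → partFraction (c n) i 1≤n) ⟶ coord a i) →
  (λ n κ≤n → density H (blowup B (c n)) κ≤n) ⟶ x

-- λB is the function a ↦ λ_H(B(a)) on the simplex; it is determined up to _≈_
-- by its first property.

uniqueMaximizer : ColouredGraph κ → Graph m → Simplex m → Set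
uniqueMaximizer {κ} {m} H B a* =
  Σ[ λB ∈ (Simplex m → ℝ) ]
    (∀ a → IsBlowupDensity H B a (λB a)) ×
    (∀ a → λB a ≤ᴿ λB a* × (λB a ≈ λB a* → ∀ i → coord a i ≈ coord a* i))

H₀ : ColouredGraph 4
H₀ .red  = fromEdges ((0F , 1F) ∷ (1F , 2F) ∷ [])
H₀ .blue = fromEdges ((0F , 2F) ∷ (0F , 3F) ∷ [])
H₀ .disjoint 0F 0F ()
H₀ .disjoint 0F 1F _ ()
H₀ .disjoint 0F 2F ()
H₀ .disjoint 0F 3F ()
H₀ .disjoint 1F 0F _ ()
H₀ .disjoint 1F 1F ()
H₀ .disjoint 1F 2F _ ()
H₀ .disjoint 1F 3F ()
H₀ .disjoint 2F 0F ()
H₀ .disjoint 2F 1F _ ()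
H₀ .disjoint 2F 2F ()
H₀ .disjoint 2F 3F ()
H₀ .disjoint 3F 0F ()
H₀ .disjoint 3F 1F ()
H₀ .disjoint 3F 2F ()
H₀ .disjoint 3F 3F ()

K₂ : Graph 2
K₂ = complete 2

equalWeights : Simplex 2
equalWeights .coord _  = fromℚ ½
equalWeights .nonneg _ ε ε>0 = 0 , λ _ _ → ℚ.≤-trans (ℚ.<⇒≤ (ℚ.positive⁻¹ ½))
  (subst (ℚ._≤ ½ ℚ.+ ε) (ℚ.+-identityʳ ½) (ℚ.+-monoʳ-≤ ½ (ℚ.<⇒≤ ε>0)))
equalWeights .sum≈1 = within , within
  where
  within : fromℚ 1ℚ ≤ᴿ fromℚ 1ℚ
  within ε ε>0 = 0 , λ _ _ → subst (ℚ._≤ 1ℚ ℚ.+ ε) (ℚ.+-identityʳ 1ℚ) (ℚ.+-monoʳ-≤ 1ℚ (ℚ.<⇒≤ ε>0))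

-- graphs and permutations are exhaustive, so maxDensity and editDistance are
-- the maximum and the minimum they are named for.

graphOf-adj : (G : Graph n) (R : Fin n → Fin n → Bool) → (∀ x y → R x y ≡ adj G x y) →
              ∀ x y → adj (graphOf R) x y ≡ adj G x y
graphOf-adj G R eq x y with x Fin.≟ y
... | yes refl = sym (adj-irr G x)
... | no  _    rewrite eq x y | eq y x | adj-sym G y x = ∨-idem (adj G x y)

density-cong : (H : ColouredGraph κ) {G G′ : Graph n} .(κ≤n : κ ≤ n) →
               (∀ x y → adj G x y ≡ adj G′ x y) → density H G κ≤n ≡ density H G′ κ≤n
density-cong {κ} {n} H {G} {G′} κ≤n eq =
  cong (λ l → _/_ (+ length l) (n P κ) {{nPk≢0 κ≤n}})
    (filter-≐ (λ v → isEmbedding? H G (lookup v)) (λ v → isEmbedding? H G′ (lookup v))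
      ((λ {v} → transport G G′ eq {v}) , λ {v} → transport G′ G (λ x y → sym (eq x y)) {v}) (vectors (allFin n) κ))
  where
  transport : (A B : Graph n) → (∀ x y → adj A x y ≡ adj B x y) →
              ∀ {v : Vec (Fin n) κ} → IsEmbedding H A (lookup v) → IsEmbedding H B (lookup v)
  transport A B e emb = mkIsEmbedding injective
    (λ i j r → subst T (e _ _) (red⇒edge i j r))
    (λ i j b → blue⇒non i j b ∘ subst T (sym (e _ _)))
    where open IsEmbedding emb

density≤maxDensity : (H : ColouredGraph κ) (G : Graph n) .(κ≤n : κ ≤ n) →
                     density H G κ≤n ℚ.≤ maxDensity H n κ≤n
density≤maxDensity {κ} {n} H G κ≤n =
  ℚ-Extrema.v≤f[argmax]⁺ {f = λ G → density H G κ≤n} (complete n) (graphs n)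
    (inj₂ (lose (∈-map⁺ _ (∈-vectors (∈-vectors bools) M)) (ℚ.≤-reflexive
      (density-cong H κ≤n λ x y → sym (graphOf-adj G _ lookupM x y)))))
  where
  M : Vec (Vec Bool n) n
  M = tabulate λ x → tabulate λ y → adj G x y

  lookupM : ∀ x y → lookup (lookup M x) y ≡ adj G x y
  lookupM x y = trans (cong (λ r → lookup r y) (lookup∘tabulate _ x)) (lookup∘tabulate _ y)

  bools : ∀ b → b ∈ true ∷ false ∷ []
  bools true  = here refl
  bools false = there (here refl)

editDistance≤ : (π : Permutation′ n) (G G′ : Graph n) → editDistance G G′ ≤ ∣E image π G △E G′ ∣
editDistance≤ {n} π G G′ = ℕ-Extrema.f[argmin]≤v⁺ {f = λ π → ∣E image π G △E G′ ∣} Perm.id (permutations n) (inj₂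
  (Any.mapMaybe⁺ toPermutation _
    (Any.map⁺ (lose (∈-cartesianProduct⁺ (∈-vectors ∈-allFin v) (∈-vectors ∈-allFin w)) found))))
  where
  v w : Vec (Fin n) n
  v = tabulate (π ⟨$⟩ʳ_)
  w = tabulate (π ⟨$⟩ˡ_)

  vw : ∀ x → lookup v (lookup w x) ≡ x
  vw x = trans (lookup∘tabulate (π ⟨$⟩ʳ_) _) (trans (cong (π ⟨$⟩ʳ_) (lookup∘tabulate (π ⟨$⟩ˡ_) x)) (inverseʳ π))

  wv : ∀ x → lookup w (lookup v x) ≡ x
  wv x = trans (lookup∘tabulate (π ⟨$⟩ˡ_) _) (trans (cong (π ⟨$⟩ˡ_) (lookup∘tabulate (π ⟨$⟩ʳ_) x)) (inverseˡ π))

  cost≡ : (ρ : Permutation′ n) → (∀ x → ρ ⟨$⟩ˡ x ≡ π ⟨$⟩ˡ x) →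
          ∣E image ρ G △E G′ ∣ ≡ ∣E image π G △E G′ ∣
  cost≡ ρ eq = cong length (filter-≐ _ _
    ( (λ { {x , y} (lt , t) → lt , subst T (xor≡ x y) t })
    , (λ { {x , y} (lt , t) → lt , subst T (sym (xor≡ x y)) t }))
    (cartesianProduct (allFin n) (allFin n)))
    where
    xor≡ : ∀ x y → (adj G (ρ ⟨$⟩ˡ x) (ρ ⟨$⟩ˡ y) xor adj G′ x y)
                 ≡ (adj G (π ⟨$⟩ˡ x) (π ⟨$⟩ˡ y) xor adj G′ x y)
    xor≡ x y rewrite eq x | eq y = refl

  found : Maybe.Any (λ ρ → ∣E image ρ G △E G′ ∣ ≤ ∣E image π G △E G′ ∣) (toPermutation (v , w))
  found with Fin.all? (λ x → lookup v (lookup w x) Fin.≟ x)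
           | Fin.all? (λ x → lookup w (lookup v x) Fin.≟ x)
  ... | yes p | yes q = Maybe.just (ℕ.≤-reflexive (cost≡ (permutation (lookup v) (lookup w) p q) (lookup∘tabulate _)))
  ... | no ¬p | _     = contradiction vw ¬p
  ... | yes _ | no ¬q = contradiction wv ¬q

{-# OPTIONS --safe #-}
module Submission where

-- For an edge ab of G let P, Q, t, z be the numbers of other vertices adjacent
-- only to b, only to a, to both, to neither. Then Λ(G) is the sum of
-- P (P + z − 1) + Q (Q + z − 1) over the edges. With A = n² − 3n + 4, the complete
-- bipartite graph with parts of sizes x and n − x has Λ = m (A − 2m) ≤ A²/8, where
-- m = x (n − x). A polynomial Φ with x Φ(x) ≤ n A² bounds the summand of ab by
-- (Φ(deg a) + Φ(deg b)) / 8n² − n (t + z) / 64, and summation over the edges gives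
-- 128 Λ(G) + n O ≤ 16 A², where O is the sum of t + z over the ordered edges.
--
-- A triple of vertices is odd if it spans one or three edges. O counts the odd
-- triples with multiplicities, and G differs from the complete bipartite graph with
-- parts N(a) and V ∖ N(a) exactly in the pairs xy with axy odd. Averaging over a
-- finds a complete bipartite graph at edit distance at most 3 O / n.
--
-- A complete bipartite graph whose parts differ by about √(3n) has Λ = A²/8 − O(n).
-- This loss is harmless: if the edit distance is not zero, the gain above is of
-- order n².

open import Data.Bool.Base using (Bool; true; false; T; not; _∧_; _xor_; if_then_else_)
open import Data.Bool.Properties using (T?; T-∧)
open import Data.Fin.Base using (Fin; zero; suc; toℕ)
open import Data.Fin.Patterns using (0F; 1F; 2F; 3F)
import Data.Fin.Permutation as Perm
import Data.Fin.Properties as Fin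
open import Data.Integer.Base as ℤ using (ℤ; +_; -[1+_]; 0ℤ; 1ℤ)
import Data.Integer.Properties as ℤ
import Data.Integer.Tactic.RingSolver as ℤ
open import Data.List.Base as List using (List; []; _∷_; _++_; length; filter; allFin; cartesianProduct; cartesianProductWith)
open import Data.Nat.Base as ℕ using (ℕ; z≤n; _<ᵇ_; _⊔_)
import Data.Nat.Properties as ℕ
import Data.Nat.Tactic.RingSolver as ℕ
open import Data.Product using (_×_; _,_; proj₁; proj₂; ∃-syntax)
open import Data.Rational.Base using (_/_)
open import Data.Sum.Base using (_⊎_; inj₁; inj₂)
open import Data.Vec.Base using (Vec; []; _∷_; lookup)
open import Function.Base using (_∘_; id)
open import Function.Bundles using (_⇔_; mk⇔; Equivalence)
open import Relation.Binary.PropositionalEquality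
open import Relation.Nullary using (¬_; Dec; yes; no; does; contradiction)
open import Relation.Nullary.Decidable using (does-⇔; _×-dec_)
open import Defs

-- Integer inequalities

-- The limit problem is degenerate: with s = u - 1/2 the limit density for parts u and 1 - u is 1/8
-- - 2 s⁴, without a quadratic term. Hence terms of lower order move the optimal parts of a finite
-- graph away from balance: m (A - 2m) peaks at 4m = A, which means a difference of √(3n - 4), in
-- general not an integer of the parity of n. So there is no simple value of λ_H(n) to compare with,
-- while perfect stability admits no error term. One edit is worth only a constant times n² in Λ, so
-- a bound n⁴/8 + O(n³) would be too weak. For this reason `A` keeps its lower terms and the bound
-- for an edge is an exact polynomial inequality, not an asymptotic one. Φ acts as a weight on
-- vertices: summed over the edges, Φ(deg a) + Φ(deg b) gives the sum of deg a · Φ(deg a) over the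
-- vertices. The global bound thus splits into an inequality for a single edge and one for a single
-- vertex.

module Integral where

  open import Data.Integer.Base using (_+_; _*_; _-_; -_; _≤_; _<_; +≤+; +<+; nonNegative; positive)
  open import Data.Integer.Tactic.RingSolver using (solve-∀)
  open import Data.Integer.Properties
  open import Algebra.Properties.Semiring.Sum +-*-semiring
    using (sum; sum-cong-≗; ∑-distrib-+; ∑-comm; *-distribˡ-sum; *-distribʳ-sum)

  0≤lit : ∀ {m} → 0ℤ ≤ + m
  0≤lit = +≤+ z≤n

  0≤+ : ∀ {i j} → 0ℤ ≤ i → 0ℤ ≤ j → 0ℤ ≤ i + j
  0≤+ = +-mono-≤

  0≤* : ∀ {i j} → 0ℤ ≤ i → 0ℤ ≤ j → 0ℤ ≤ i * j
  0≤* {i} {j} 0≤i 0≤j = subst (_≤ i * j) (*-zeroʳ i) (*-monoˡ-≤-nonNeg i {{nonNegative 0≤i}} 0≤j)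

  0≤² : ∀ i → 0ℤ ≤ i * i
  0≤² (+ n)    = subst (0ℤ ≤_) (pos-* n n) 0≤lit
  0≤² -[1+ n ] = 0≤lit

  -- Reduces a nonlinear inequality to a polynomial identity: the slack `s` is written so that its
  -- sign is visible, and the ring solver checks the equation.
  ≤-by : ∀ {i j} s → 0ℤ ≤ s → j ≡ i + s → i ≤ j
  ≤-by {i} s 0≤s eq = subst₂ _≤_ (+-identityʳ i) (sym eq) (+-monoʳ-≤ i 0≤s)

  -- A complete bipartite graph of order n with a part of size x has Λ = m (A n − 2 m),
  -- where m = x (n − x). The first summand of Φ, which is 8n times (n − x) (A n − 2 m),
  -- makes the edge bound tight for these graphs. The square is needed for edges
  -- between vertices of very different degrees and is free, by
  -- 8 m (A n − 2 m) + (A n − 4 m)² = (A n)².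
  A k : ℤ → ℤ
  A n = n * n - + 3 * n + + 4
  k n = + 3 * n - + 4

  Φ : ℤ → ℤ → ℤ
  Φ n x = + 8 * n * (n - x) * (A n - + 2 * (x * (n - x)))
        + (A n - + 4 * (x * (n - x))) * (A n - + 4 * (x * (n - x)))

  -- Here p = P + 1 and q = Q + 1 in Φ-excess, and D = p − q, R = p + q + 2 z. The sign
  -- of excess is found by completing the square in D².
  excess : (n D R t z : ℤ) → ℤ
  excess n D R t z = + 2 * (D * D * (D * D)) - + 12 * (D * D * w * R) - + 4 * (k n * (D * D)) + + 2 * (k n * k n)
          + n * (+ 4 * (z * R * R) + + 4 * (t * R * R) + + 8 * (t * R * w)) + + 2 * (w * w * (w * w)) - + 4 * (k n * (w * w))
          - + 32 * (n * (n * z - z + t))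
    where w = t - z

  -- The summand P (P + z - 1) reads (p - 1) (p + z - 2) here. For t = z = 0 the excess is 2 (D² -
  -- k)², which vanishes exactly at the optimal difference D² = 3n - 4; in general it has to pay for
  -- t + z.
  Φ-excess : ∀ p q t z → let n = p + q + t + z in
    Φ n (q + t) + Φ n (p + t) ≡
      + 8 * (n * n) * ((p - + 1) * (p + z - + 2) + (q - + 1) * (q + z - + 2)) + excess n (p - q) (p + q + + 2 * z) t z
  Φ-excess = identity
    where
    identity : ∀ p q t z →
      let n = p + q + t + z ; x = q + t; y = p + t; A = n * n - + 3 * n + + 4 ; k = + 3 * n - + 4
          w = t - z ; R = p + q + + 2 * z ; D = p - q
          Φ = λ x → + 8 * n * (n - x) * (A - + 2 * (x * (n - x))) + (A - + 4 * (x * (n - x))) * (A - + 4 * (x * (n - x)))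
      in Φ x + Φ y ≡ + 8 * (n * n) * ((p - + 1) * (p + z - + 2) + (q - + 1) * (q + z - + 2))
          + (+ 2 * (D * D * (D * D)) - + 12 * (D * D * w * R) - + 4 * (k * (D * D)) + + 2 * (k * k)
            + n * (+ 4 * (z * R * R) + + 4 * (t * R * R) + + 8 * (t * R * w)) + + 2 * (w * w * (w * w)) - + 4 * (k * (w * w))
            - + 32 * (n * (n * z - z + t)))
    identity = solve-∀

  0≤k : ∀ n → 0ℤ ≤ n - + 288 → 0ℤ ≤ k n
  0≤k n h = subst (0ℤ ≤_) (identity n) (0≤+ (0≤* (0≤lit {3}) h) (0≤lit {860}))
    where
    identity : ∀ n → + 3 * (n - + 288) + + 860 ≡ + 3 * n - + 4
    identity = solve-∀

  -- For w ≥ 0 the term -12 D² w R has the wrong sign and goes into the square 2 (D² - 3 w R - k)².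
  -- This costs 18 w² R² + 12 k w R. The first is covered by the other terms of degree four. The
  -- second, after the factor 8 and by k < 3n and R ≤ n, is at most 288 n² w: the origin of the
  -- threshold 288.
  excess-t≥z : ∀ S D w z → 0ℤ ≤ S → 0ℤ ≤ w → 0ℤ ≤ z → let t = z + w; n = S + t + z in 0ℤ ≤ n - + 288 →
    n * n * n * (t + z) ≤ + 8 * excess n D (S + + 2 * z) t z
  excess-t≥z S D w z hS hw hz hn = ≤-by _
    (0≤+ (0≤+ (0≤+ (0≤+ (0≤+ (0≤+ (0≤+ (0≤+
      (0≤* (0≤lit {16}) (0≤² (D * D - + 3 * w * R - k n)))
      (0≤* (0≤* (0≤lit {60}) (0≤* hz hR)) (0≤² n)))
      (0≤* (0≤* (0≤lit {2}) (0≤* hS hw)) (0≤² n)))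
      (0≤* (0≤* hw hR) (0≤+ (0≤+ (0≤+ (0≤² (+ 5 * R - + 6 * w)) (0≤* (0≤lit {3}) (0≤² R)))
        (0≤* (0≤lit {2}) (0≤* hR hw))) (0≤* (0≤lit {20}) (0≤² w)))))
      (0≤* (0≤lit {14}) (0≤² (w * w))))
      (0≤* (0≤* (0≤² n) (0≤+ hw (0≤* (0≤lit {2}) hz))) hn))
      (0≤* (0≤lit {320}) (0≤* (0≤² n) hz)))
      (0≤* (0≤lit {128}) (0≤* h0n hw)))
      (0≤* (0≤lit {64}) (0≤* (0≤² w) (0≤k n hn))))
    (identity S D w z)
    where
    t n R : ℤ
    t = z + w
    n = S + t + z
    R = S + + 2 * z
    hR : 0ℤ ≤ R
    hR = 0≤+ hS (0≤* (0≤lit {2}) hz)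
    h0n : 0ℤ ≤ n
    h0n = 0≤+ (0≤+ hS (0≤+ hz hw)) hz
    identity : ∀ S D w₀ z → let t = z + w₀; n = S + t + z; R = S + + 2 * z; w = t - z; k = + 3 * n - + 4 in
      + 8 * (+ 2 * (D * D * (D * D)) - + 12 * (D * D * w * R) - + 4 * (k * (D * D)) + + 2 * (k * k)
          + n * (+ 4 * (z * R * R) + + 4 * (t * R * R) + + 8 * (t * R * w)) + + 2 * (w * w * (w * w)) - + 4 * (k * (w * w))
          - + 32 * (n * (n * z - z + t)))
      ≡ n * n * n * (t + z) +
      (+ 16 * ((D * D - + 3 * w₀ * R - k) * (D * D - + 3 * w₀ * R - k))
       + + 60 * (z * R) * (n * n)
       + + 2 * (S * w₀) * (n * n)
       + w₀ * R * ((+ 5 * R - + 6 * w₀) * (+ 5 * R - + 6 * w₀) + + 3 * (R * R) + + 2 * (R * w₀) + + 20 * (w₀ * w₀))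
       + + 14 * (w₀ * w₀ * (w₀ * w₀))
       + n * n * (w₀ + + 2 * z) * (n - + 288)
       + + 320 * (n * n * z)
       + + 128 * (n * w₀)
       + + 64 * (w₀ * w₀ * k))
    identity = solve-∀

  -- Now w = -u ≤ 0, so -12 D² w R is a gain, and only D² against `k` needs a square.
  excess-z≥t : ∀ S D u t → 0ℤ ≤ S → 0ℤ ≤ u → 0ℤ ≤ t → let z = t + u; n = S + t + z in 0ℤ ≤ n - + 288 →
    n * n * n * (t + z) ≤ + 8 * excess n D (S + + 2 * z) t z
  excess-z≥t S D u t hS hu ht hn = ≤-by _
    (0≤+ (0≤+ (0≤+ (0≤+ (0≤+ (0≤+ (0≤+ (0≤+ (0≤+
      (0≤* (0≤lit {16}) (0≤² (D * D - k n)))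
      (0≤* (0≤lit {96}) (0≤* (0≤² D) (0≤* hu hR))))
      (0≤* (0≤lit {32}) (0≤* (0≤* (0≤* h0n hz) hu) (0≤+ hR h0n))))
      (0≤* (0≤lit {32}) (0≤* (0≤* (0≤* h0n ht) hR) (0≤+ hS (0≤* (0≤lit {2}) ht)))))
      (0≤* (0≤lit {16}) (0≤² (u * u))))
      (0≤* (0≤* (0≤² n) h0n) hu))
      (0≤* (0≤lit {96}) (0≤* h0n (0≤+ (0≤* (0≤+ hS (0≤* (0≤lit {2}) ht)) hz) (0≤* hu ht)))))
      (0≤* (0≤lit {128}) (0≤² u)))
      (0≤* (0≤lit {256}) (0≤* h0n hu)))
      (0≤* (0≤* (0≤² n) hz) (0≤+ (0≤* (0≤lit {30}) hn) (0≤lit {8288}))))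
    (identity S D u t)
    where
    z n R : ℤ
    z = t + u
    n = S + t + z
    R = S + + 2 * z
    hz : 0ℤ ≤ z
    hz = 0≤+ ht hu
    hR : 0ℤ ≤ R
    hR = 0≤+ hS (0≤* (0≤lit {2}) hz)
    h0n : 0ℤ ≤ n
    h0n = 0≤+ (0≤+ hS ht) hz
    identity : ∀ S D u t → let z = t + u; n = S + t + z; R = S + + 2 * z; w = t - z; k = + 3 * n - + 4 in
      + 8 * (+ 2 * (D * D * (D * D)) - + 12 * (D * D * w * R) - + 4 * (k * (D * D)) + + 2 * (k * k)
          + n * (+ 4 * (z * R * R) + + 4 * (t * R * R) + + 8 * (t * R * w)) + + 2 * (w * w * (w * w)) - + 4 * (k * (w * w))
          - + 32 * (n * (n * z - z + t)))
      ≡ n * n * n * (t + z) +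
      (+ 16 * ((D * D - k) * (D * D - k))
       + + 96 * (D * D * (u * R))
       + + 32 * (n * z * u * (R + n))
       + + 32 * (n * t * R * (S + + 2 * t))
       + + 16 * (u * u * (u * u))
       + n * n * n * u
       + + 96 * (n * ((S + + 2 * t) * z + u * t))
       + + 128 * (u * u)
       + + 256 * (n * u)
       + n * n * z * (+ 30 * (n - + 288) + + 8288))
    identity = solve-∀

  i+[j-i]≡j : ∀ i j → i + (j - i) ≡ j
  i+[j-i]≡j = solve-∀

  excess-bound : ∀ S D t z → 0ℤ ≤ S → 0ℤ ≤ t → 0ℤ ≤ z → let n = S + t + z in 0ℤ ≤ n - + 288 →
    n * n * n * (t + z) ≤ + 8 * excess n D (S + + 2 * z) t z
  excess-bound S D t z hS ht hz hn = cases (≤-total z t)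
    where
    Bound : ℤ → ℤ → Set
    Bound t z = let n = S + t + z in
      0ℤ ≤ n - + 288 → n * n * n * (t + z) ≤ + 8 * excess n D (S + + 2 * z) t z
    cases : z ≤ t ⊎ t ≤ z → let n = S + t + z in n * n * n * (t + z) ≤ + 8 * excess n D (S + + 2 * z) t z
    cases (inj₁ z≤t) = subst (λ t → Bound t z) (i+[j-i]≡j z t) (excess-t≥z S D (t - z) z hS (i≤j⇒0≤j-i z≤t) hz) hn
    cases (inj₂ t≤z) = subst (λ z → Bound t z) (i+[j-i]≡j t z) (excess-z≥t S D (z - t) t hS (i≤j⇒0≤j-i t≤z) ht) hn

  -- Finite sums, and counts as sums of indicators

  private variable
    α β γ : Set
    n : ℕ

  ind : Bool → ℤ
  ind true  = 1ℤ
  ind false = 0ℤ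

  0≤ind : ∀ b → 0ℤ ≤ ind b
  0≤ind true  = 0≤lit
  0≤ind false = 0≤lit

  sum₂ : (Fin n → Fin n → ℤ) → ℤ
  sum₂ f = sum λ x → sum λ y → f x y

  sum-mono : {f g : Fin n → ℤ} → (∀ x → f x ≤ g x) → sum f ≤ sum g
  sum-mono {ℕ.zero}  h = ≤-refl
  sum-mono {ℕ.suc n} h = +-mono-≤ (h zero) (sum-mono (h ∘ suc))

  sum-const : ∀ n i → sum {n} (λ _ → i) ≡ + n * i
  sum-const ℕ.zero i = refl
  sum-const (ℕ.suc n) i = trans (cong (λ s → i + s) (sum-const n i)) (identity i (+ n))
    where
    identity : ∀ i m → i + m * i ≡ (1ℤ + m) * i
    identity = solve-∀

  0≤sum : {f : Fin n → ℤ} → (∀ x → 0ℤ ≤ f x) → 0ℤ ≤ sum f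
  0≤sum {n} {f} h = subst (_≤ sum f) (trans (sum-const n 0ℤ) (*-zeroʳ (+ n))) (sum-mono h)

  sum₂-cong : {f g : Fin n → Fin n → ℤ} → (∀ x y → f x y ≡ g x y) → sum₂ f ≡ sum₂ g
  sum₂-cong h = sum-cong-≗ λ x → sum-cong-≗ (h x)

  sum₂-mono : {f g : Fin n → Fin n → ℤ} → (∀ x y → f x y ≤ g x y) → sum₂ f ≤ sum₂ g
  sum₂-mono h = sum-mono λ x → sum-mono (h x)

  sum₂-+ : (f g : Fin n → Fin n → ℤ) → sum₂ (λ x y → f x y + g x y) ≡ sum₂ f + sum₂ g
  sum₂-+ f g = trans (sum-cong-≗ λ x → ∑-distrib-+ (f x) (g x)) (∑-distrib-+ (sum ∘ f) (sum ∘ g))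

  sum₂-*ˡ : ∀ i (f : Fin n → Fin n → ℤ) → sum₂ (λ x y → i * f x y) ≡ i * sum₂ f
  sum₂-*ˡ i f = sym (trans (*-distribˡ-sum i (sum ∘ f)) (sum-cong-≗ λ x → *-distribˡ-sum i (f x)))

  -- Counts are lengths of filtered lists. `∑ₗ` carries them to sums over `Fin n`, where summations
  -- can be exchanged.
  ∑ₗ : (α → ℤ) → List α → ℤ
  ∑ₗ f []       = 0ℤ
  ∑ₗ f (x ∷ xs) = f x + ∑ₗ f xs

  ∑ₗ-++ : (f : α → ℤ) (xs ys : List α) → ∑ₗ f (xs ++ ys) ≡ ∑ₗ f xs + ∑ₗ f ys
  ∑ₗ-++ f []       ys = sym (+-identityˡ _)
  ∑ₗ-++ f (x ∷ xs) ys = trans (cong (λ s → f x + s) (∑ₗ-++ f xs ys)) (sym (+-assoc (f x) _ _))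

  ∑ₗ-map : (f : β → ℤ) (g : α → β) (xs : List α) → ∑ₗ f (List.map g xs) ≡ ∑ₗ (f ∘ g) xs
  ∑ₗ-map f g []       = refl
  ∑ₗ-map f g (x ∷ xs) = cong (λ s → f (g x) + s) (∑ₗ-map f g xs)

  ∑ₗ-cartesianProductWith : (f : γ → ℤ) (g : α → β → γ) (xs : List α) (ys : List β) →
    ∑ₗ f (cartesianProductWith g xs ys) ≡ ∑ₗ (λ x → ∑ₗ (λ y → f (g x y)) ys) xs
  ∑ₗ-cartesianProductWith f g []       ys = refl
  ∑ₗ-cartesianProductWith f g (x ∷ xs) ys = trans (∑ₗ-++ f (List.map (g x) ys) _)
    (cong₂ _+_ (∑ₗ-map f (g x) ys) (∑ₗ-cartesianProductWith f g xs ys))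

  ∑ₗ-tabulate : (f : α → ℤ) (g : Fin n → α) → ∑ₗ f (List.tabulate g) ≡ sum (f ∘ g)
  ∑ₗ-tabulate {n = ℕ.zero}  f g = refl
  ∑ₗ-tabulate {n = ℕ.suc n} f g = cong (λ s → f (g zero) + s) (∑ₗ-tabulate f (g ∘ suc))

  length-filter : {P : α → Set} (P? : ∀ x → Dec (P x)) (xs : List α) →
    + length (filter P? xs) ≡ ∑ₗ (λ x → ind (does (P? x))) xs
  length-filter P? [] = refl
  length-filter P? (x ∷ xs) with does (P? x)
  ... | true  = cong (λ s → 1ℤ + s) (length-filter P? xs)
  ... | false = trans (length-filter P? xs) (sym (+-identityˡ _))

  ∑ₗ-vectors : ∀ k (f : Vec (Fin n) (ℕ.suc k) → ℤ) →
    ∑ₗ f (vectors (allFin n) (ℕ.suc k)) ≡ sum (λ x → ∑ₗ (λ v → f (x ∷ v)) (vectors (allFin n) k))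
  ∑ₗ-vectors {n} k f = trans (∑ₗ-cartesianProductWith f _∷_ (allFin n) (vectors (allFin n) k))
    (∑ₗ-tabulate (λ x → ∑ₗ (λ v → f (x ∷ v)) (vectors (allFin n) k)) id)

  ∑ₗ-vectors₄ : (f : Vec (Fin n) 4 → ℤ) →
    ∑ₗ f (vectors (allFin n) 4) ≡ sum₂ λ a b → sum₂ λ c d → f (a ∷ b ∷ c ∷ d ∷ [])
  ∑ₗ-vectors₄ f = trans (∑ₗ-vectors 3 f) (sum-cong-≗ λ a →
    trans (∑ₗ-vectors 2 λ v → f (a ∷ v)) (sum-cong-≗ λ b →
    trans (∑ₗ-vectors 1 λ v → f (a ∷ b ∷ v)) (sum-cong-≗ λ c →
    trans (∑ₗ-vectors 0 λ v → f (a ∷ b ∷ c ∷ v)) (sum-cong-≗ λ d → +-identityʳ (f (a ∷ b ∷ c ∷ d ∷ []))))))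

  δ : Fin n → Fin n → ℤ
  δ x y = ind (does (x Fin.≟ y))

  sum-δ : (f : Fin n → ℤ) (a : Fin n) → sum (λ x → f x * δ a x) ≡ f a
  sum-δ {ℕ.suc n} f zero = trans (cong₂ _+_ (*-identityʳ (f zero))
      (trans (sum-cong-≗ λ x → *-zeroʳ (f (suc x))) (trans (sum-const n 0ℤ) (*-zeroʳ (+ n))))) (+-identityʳ (f zero))
  sum-δ {ℕ.suc n} f (suc a) = trans (cong (_+ sum (λ x → f (suc x) * δ a x)) (*-zeroʳ (f zero)))
    (trans (+-identityˡ _) (sum-δ (f ∘ suc) a))

  -- Counting embeddings

  module Counting (G : Graph n) where

    nonadj : Fin n → Fin n → Bool
    nonadj x y = not (adj G x y) ∧ not (does (x Fin.≟ y))

    e h : Fin n → Fin n → ℤ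
    e x y = ind (adj G x y)
    h x y = ind (nonadj x y)

    e-sym : ∀ x y → e x y ≡ e y x
    e-sym x y = cong ind (adj-sym G x y)

    e+h+δ≡1 : ∀ x y → e x y + h x y + δ x y ≡ 1ℤ
    e+h+δ≡1 x y with x Fin.≟ y
    ... | yes refl rewrite adj-irr G x = refl
    ... | no _ with adj G x y
    ...   | true  = refl
    ...   | false = refl

    h-sym : ∀ x y → h x y ≡ h y x
    h-sym x y = cong₂ (λ a b → ind (not a ∧ not b)) (adj-sym G x y)
      (does-⇔ (mk⇔ sym sym) (x Fin.≟ y) (y Fin.≟ x))

    h*h≡h : ∀ x y → h x y * h x y ≡ h x y
    h*h≡h x y with nonadj x y
    ... | true  = refl
    ... | false = refl

    deg codeg : Fin n → ℤ
    deg x   = sum (e x)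
    codeg x = sum (h x)

    -- For adjacent a and b, the numbers P, Q, t, z of the header are P a b, P b a, t a b, z a b.
    P t z : Fin n → Fin n → ℤ
    P a b = sum λ c → e b c * h a c
    t a b = sum λ c → e b c * e a c
    z a b = sum λ c → h b c * h a c

    0≤P : ∀ a b → 0ℤ ≤ P a b
    0≤P a b = 0≤sum λ c → 0≤* (0≤ind (adj G b c)) (0≤ind (nonadj a c))
    0≤t : ∀ a b → 0ℤ ≤ t a b
    0≤t a b = 0≤sum λ c → 0≤* (0≤ind (adj G b c)) (0≤ind (adj G a c))
    0≤z : ∀ a b → 0ℤ ≤ z a b
    0≤z a b = 0≤sum λ c → 0≤* (0≤ind (nonadj b c)) (0≤ind (nonadj a c))

    -- The vertices are the neighbours of `a`, its non-neighbours, and `a` itself. Taking `e b`,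
    -- `h a` or 1 for `f` yields every relation between degrees, codegrees, the order and `P`, `t`,
    -- `z`.
    sum-split : (f : Fin n → ℤ) (a : Fin n) →
      sum f ≡ sum (λ c → f c * e a c) + sum (λ c → f c * h a c) + f a
    sum-split f a = begin
      sum f
        ≡⟨ sum-cong-≗ (λ c → split c) ⟩
      sum (λ c → f c * e a c + f c * h a c + f c * δ a c)
        ≡⟨ ∑-distrib-+ (λ c → f c * e a c + f c * h a c) (λ c → f c * δ a c) ⟩
      sum (λ c → f c * e a c + f c * h a c) + sum (λ c → f c * δ a c)
        ≡⟨ cong₂ _+_ (∑-distrib-+ (λ c → f c * e a c) (λ c → f c * h a c)) (sum-δ f a) ⟩
      sum (λ c → f c * e a c) + sum (λ c → f c * h a c) + f a ∎
      where
      open ≡-Reasoning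
      distrib : ∀ x e h δ → x * (e + h + δ) ≡ x * e + x * h + x * δ
      distrib = solve-∀
      split : ∀ c → f c ≡ f c * e a c + f c * h a c + f c * δ a c
      split c = trans (sym (*-identityʳ (f c))) (trans (cong (f c *_) (sym (e+h+δ≡1 a c))) (distrib (f c) (e a c) (h a c) (δ a c)))

    deg-split : ∀ a b → deg b ≡ t a b + P a b + e b a
    deg-split a b = sum-split (e b) a

    codeg-split : ∀ a b → codeg a ≡ P a b + z a b + h a b
    codeg-split a b = trans (sum-split (h a) b)
      (cong (_+ h a b) (cong₂ _+_ (sum-cong-≗ λ c → *-comm (h a c) (e b c)) (sum-cong-≗ λ c → *-comm (h a c) (h b c))))

    order-split : ∀ a → + n ≡ deg a + codeg a + 1ℤ
    order-split a = trans (trans (sym (*-identityʳ (+ n))) (sym (sum-const n 1ℤ))) (trans (sum-split (λ _ → 1ℤ) a)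
      (cong (_+ 1ℤ) (cong₂ _+_ (sum-cong-≗ λ c → *-identityˡ (e a c)) (sum-cong-≗ λ c → *-identityˡ (h a c)))))

    t-sym : ∀ a b → t a b ≡ t b a
    t-sym a b = sum-cong-≗ λ c → *-comm (e b c) (e a c)

    z-sym : ∀ a b → z a b ≡ z b a
    z-sym a b = sum-cong-≗ λ c → *-comm (h b c) (h a c)

    -- Of the six inequalities between vertices only c ≠ d is spelled out. `nonadj` contains a ≠ c
    -- and a ≠ d; adjacency gives a ≠ b and b ≠ c; and b ≠ d because `a` is adjacent to `b` but not
    -- to `d`.
    isH₀ : Fin n → Fin n → Fin n → Fin n → Bool
    isH₀ a b c d = adj G a b ∧ (adj G b c ∧ nonadj a c) ∧ (nonadj a d ∧ not (does (c Fin.≟ d)))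

    T-nonadj : ∀ x y → T (nonadj x y) ⇔ (¬ T (adj G x y) × x ≢ y)
    T-nonadj x y with adj G x y | x Fin.≟ y
    ... | true  | _      = mk⇔ (λ ()) (λ (¬p , _) → ¬p _)
    ... | false | yes eq = mk⇔ (λ ()) (λ (_ , ¬q) → ¬q eq)
    ... | false | no neq = mk⇔ (λ _ → (λ ()) , neq) _

    T-≢ : ∀ (x y : Fin n) → T (not (does (x Fin.≟ y))) ⇔ x ≢ y
    T-≢ x y with x Fin.≟ y
    ... | yes eq = mk⇔ (λ ()) (λ ¬q → ¬q eq)
    ... | no neq = mk⇔ (λ _ → neq) _

    adj⇒≢ : ∀ {x y} → T (adj G x y) → x ≢ y
    adj⇒≢ {x} p refl = subst T (adj-irr G x) p

    isEmbedding⇔ : ∀ a b c d → IsEmbedding H₀ G (lookup (a ∷ b ∷ c ∷ d ∷ [])) ⇔ T (isH₀ a b c d)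
    isEmbedding⇔ a b c d = mk⇔ forth back
      where
      open Equivalence
      forth : IsEmbedding H₀ G (lookup (a ∷ b ∷ c ∷ d ∷ [])) → T (isH₀ a b c d)
      forth emb = from T-∧ (red⇒edge 0F 1F _ , from T-∧
        ( from T-∧ (red⇒edge 1F 2F _ , from (T-nonadj a c) (blue⇒non 0F 2F _ , λ eq → contradiction (injective {0F} {2F} eq) λ ()))
        , from T-∧ (from (T-nonadj a d) (blue⇒non 0F 3F _ , λ eq → contradiction (injective {0F} {3F} eq) λ ())
                   , from (T-≢ c d) (λ eq → contradiction (injective {2F} {3F} eq) λ ()))))
        where open IsEmbedding emb
      back : T (isH₀ a b c d) → IsEmbedding H₀ G (lookup (a ∷ b ∷ c ∷ d ∷ []))
      back p with to (T-∧ {adj G a b}) p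
      ... | ab , q with to (T-∧ {adj G b c ∧ nonadj a c}) q
      ... | r , s with to (T-∧ {adj G b c}) r | to (T-∧ {nonadj a d}) s
      ... | bc , nac | nad , ncd with to (T-nonadj a c) nac | to (T-nonadj a d) nad | to (T-≢ c d) ncd
      ... | ¬ac , a≢c | ¬ad , a≢d | c≢d = mkIsEmbedding inj red′ blue′
        where
        swap : ∀ {x y} → T (adj G x y) → T (adj G y x)
        swap {x} {y} = subst T (adj-sym G x y)
        b≢d : b ≢ d
        b≢d refl = ¬ad ab
        inj : ∀ {i j} → lookup (a ∷ b ∷ c ∷ d ∷ []) i ≡ lookup (a ∷ b ∷ c ∷ d ∷ []) j → i ≡ j
        inj {0F} {0F} _ = refl
        inj {0F} {1F} eq = contradiction eq (adj⇒≢ ab)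
        inj {0F} {2F} eq = contradiction eq a≢c
        inj {0F} {3F} eq = contradiction eq a≢d
        inj {1F} {0F} eq = contradiction (sym eq) (adj⇒≢ ab)
        inj {1F} {1F} _ = refl
        inj {1F} {2F} eq = contradiction eq (adj⇒≢ bc)
        inj {1F} {3F} eq = contradiction eq b≢d
        inj {2F} {0F} eq = contradiction (sym eq) a≢c
        inj {2F} {1F} eq = contradiction (sym eq) (adj⇒≢ bc)
        inj {2F} {2F} _ = refl
        inj {2F} {3F} eq = contradiction eq c≢d
        inj {3F} {0F} eq = contradiction (sym eq) a≢d
        inj {3F} {1F} eq = contradiction (sym eq) b≢d
        inj {3F} {2F} eq = contradiction (sym eq) c≢d
        inj {3F} {3F} _ = refl
        red′ : ∀ i j → T (adj (red H₀) i j) → T (adj G (lookup (a ∷ b ∷ c ∷ d ∷ []) i) (lookup (a ∷ b ∷ c ∷ d ∷ []) j))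
        red′ 0F 1F _ = ab
        red′ 1F 0F _ = swap ab
        red′ 1F 2F _ = bc
        red′ 2F 1F _ = swap bc
        red′ 0F 0F ()
        red′ 0F 2F ()
        red′ 0F 3F ()
        red′ 1F 1F ()
        red′ 1F 3F ()
        red′ 2F 0F ()
        red′ 2F 2F ()
        red′ 2F 3F ()
        red′ 3F 0F ()
        red′ 3F 1F ()
        red′ 3F 2F ()
        red′ 3F 3F ()
        blue′ : ∀ i j → T (adj (blue H₀) i j) → ¬ T (adj G (lookup (a ∷ b ∷ c ∷ d ∷ []) i) (lookup (a ∷ b ∷ c ∷ d ∷ []) j))
        blue′ 0F 2F _ = ¬ac
        blue′ 2F 0F _ = ¬ac ∘ swap
        blue′ 0F 3F _ = ¬ad
        blue′ 3F 0F _ = ¬ad ∘ swap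
        blue′ 0F 0F ()
        blue′ 0F 1F ()
        blue′ 1F 0F ()
        blue′ 1F 1F ()
        blue′ 1F 2F ()
        blue′ 1F 3F ()
        blue′ 2F 1F ()
        blue′ 2F 2F ()
        blue′ 2F 3F ()
        blue′ 3F 1F ()
        blue′ 3F 2F ()
        blue′ 3F 3F ()

    ind-∧ : ∀ a b → ind (a ∧ b) ≡ ind a * ind b
    ind-∧ true  b = sym (*-identityˡ (ind b))
    ind-∧ false b = refl

    ind-not-δ : ∀ (c d : Fin n) → ind (not (does (c Fin.≟ d))) ≡ 1ℤ - δ c d
    ind-not-δ c d with does (c Fin.≟ d)
    ... | true  = refl
    ... | false = refl

    -- The dependence on `d` is collected in one factor, with c ≠ d written as 1 - δ, so that
    -- `sum-δ` can evaluate the sum over `d`.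
    ind-isH₀ : ∀ a b c d → ind (isH₀ a b c d) ≡ e a b * (e b c * h a c) * (h a d + - h a d * δ c d)
    ind-isH₀ a b c d = begin
      ind (isH₀ a b c d)
        ≡⟨ ind-∧ (adj G a b) _ ⟩
      e a b * ind ((adj G b c ∧ nonadj a c) ∧ (nonadj a d ∧ not (does (c Fin.≟ d))))
        ≡⟨ cong (e a b *_) (trans (ind-∧ (adj G b c ∧ nonadj a c) _) (cong₂ _*_ (ind-∧ (adj G b c) _)
             (trans (ind-∧ (nonadj a d) _) (cong (h a d *_) (ind-not-δ c d))))) ⟩
      e a b * (e b c * h a c * (h a d * (1ℤ - δ c d)))
        ≡⟨ rearrange (e a b) (e b c) (h a c) (h a d) (δ c d) ⟩
      e a b * (e b c * h a c) * (h a d + - h a d * δ c d) ∎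
      where
      open ≡-Reasoning
      rearrange : ∀ eab ebc hac had δ → eab * (ebc * hac * (had * (1ℤ - δ))) ≡ eab * (ebc * hac) * (had + - had * δ)
      rearrange = solve-∀

    -- `d` is any non-neighbour of `a` except `c`, and `c` is one whenever the factor `h a c` is not
    -- zero. Idempotence of `h` merges the two copies of this factor.
    sum-isH₀ : ∀ a b c → sum (λ d → ind (isH₀ a b c d)) ≡ e a b * (codeg a - 1ℤ) * (e b c * h a c)
    sum-isH₀ a b c = begin
      sum (λ d → ind (isH₀ a b c d))
        ≡⟨ sum-cong-≗ (ind-isH₀ a b c) ⟩
      sum (λ d → e a b * (e b c * h a c) * (h a d + - h a d * δ c d))
        ≡⟨ sym (*-distribˡ-sum (e a b * (e b c * h a c)) λ d → h a d + - h a d * δ c d) ⟩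
      e a b * (e b c * h a c) * sum (λ d → h a d + - h a d * δ c d)
        ≡⟨ cong (e a b * (e b c * h a c) *_) (trans (∑-distrib-+ (h a) λ d → - h a d * δ c d)
             (cong (λ s → codeg a + s) (sum-δ (λ d → - h a d) c))) ⟩
      e a b * (e b c * h a c) * (codeg a + - h a c)
        ≡⟨ expand (e a b) (e b c) (h a c) (codeg a) ⟩
      e a b * e b c * (codeg a * h a c - h a c * h a c)
        ≡⟨ cong (λ s → e a b * e b c * (codeg a * h a c - s)) (h*h≡h a c) ⟩
      e a b * e b c * (codeg a * h a c - h a c)
        ≡⟨ collect (e a b) (e b c) (h a c) (codeg a) ⟩
      e a b * (codeg a - 1ℤ) * (e b c * h a c) ∎
      where
      open ≡-Reasoning
      expand : ∀ eab ebc hac cd → eab * (ebc * hac) * (cd + - hac) ≡ eab * ebc * (cd * hac - hac * hac)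
      expand = solve-∀
      collect : ∀ eab ebc hac cd → eab * ebc * (cd * hac - hac) ≡ eab * (cd - 1ℤ) * (ebc * hac)
      collect = solve-∀

    -- On an edge `codeg a` is P + z, so the ordered pairs (a, b) and (b, a) together contribute P
    -- (P + z - 1) + Q (Q + z - 1).
    Λ-sum : + Λ H₀ G ≡ sum₂ (λ a b → e a b * ((codeg a - 1ℤ) * P a b))
    Λ-sum = begin
      + Λ H₀ G
        ≡⟨ length-filter (λ v → isEmbedding? H₀ G (lookup v)) (vectors (allFin n) 4) ⟩
      ∑ₗ emb (vectors (allFin n) 4)
        ≡⟨ ∑ₗ-vectors₄ emb ⟩
      (sum₂ λ a b → sum₂ λ c d → emb (a ∷ b ∷ c ∷ d ∷ []))
        ≡⟨ sum₂-cong (λ a b → sum₂-cong λ c d → cong ind (does-⇔ (isEmbedding⇔ a b c d)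
             (isEmbedding? H₀ G (lookup (a ∷ b ∷ c ∷ d ∷ []))) (T? (isH₀ a b c d)))) ⟩
      (sum₂ λ a b → sum₂ λ c d → ind (isH₀ a b c d))
        ≡⟨ sum₂-cong (λ a b → trans (sum-cong-≗ (sum-isH₀ a b))
             (sym (*-distribˡ-sum (e a b * (codeg a - 1ℤ)) λ c → e b c * h a c))) ⟩
      (sum₂ λ a b → e a b * (codeg a - 1ℤ) * P a b)
        ≡⟨ sum₂-cong (λ a b → *-assoc (e a b) (codeg a - 1ℤ) (P a b)) ⟩
      (sum₂ λ a b → e a b * ((codeg a - 1ℤ) * P a b)) ∎
      where
      open ≡-Reasoning
      emb : Vec (Fin n) 4 → ℤ
      emb v = ind (does (isEmbedding? H₀ G (lookup v)))

  -- The upper bound and the nearest complete bipartite graph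

  -- With m = x (n - x), n times the identity 8 m (A - 2m) + (A - 4m)² = A² contains the square n
  -- times, while x Φ uses it only x times.
  xΦ≤nA² : ∀ n x → 0ℤ ≤ n - x → x * Φ n x ≤ n * (A n * A n)
  xΦ≤nA² n x h = ≤-by _ (0≤* h (0≤² (A n - + 4 * (x * (n - x))))) (identity n x)
    where
    identity : ∀ n x → let A = n * n - + 3 * n + + 4 ; m = x * (n - x) in
      n * (A * A) ≡ x * (+ 8 * n * (n - x) * (A - + 2 * m) + (A - + 4 * m) * (A - + 4 * m)) + (n - x) * ((A - + 4 * m) * (A - + 4 * m))
    identity = solve-∀

  -- Eight times `Φ-excess`, with `excess-bound` for the excess. The added ones in the degrees and
  -- in `n` are the two endpoints, which P and Q leave out.
  edge-bound : ∀ {P Q t z n d d′ c c′} → 0ℤ ≤ P → 0ℤ ≤ Q → 0ℤ ≤ t → 0ℤ ≤ z → 0ℤ ≤ n - + 288 →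
    d ≡ (Q + 1ℤ) + t → d′ ≡ (P + 1ℤ) + t → c ≡ P + z → c′ ≡ Q + z → n ≡ (P + 1ℤ) + (Q + 1ℤ) + t + z →
    + 64 * (n * n) * ((c - 1ℤ) * P + (c′ - 1ℤ) * Q) + n * n * n * (t + z) ≤ + 8 * (Φ n d + Φ n d′)
  edge-bound {P} {Q} {t} {z} 0≤P 0≤Q 0≤t 0≤z 0≤n-288 refl refl refl refl refl = begin
    + 64 * (N * N) * ((P + z - 1ℤ) * P + (Q + z - 1ℤ) * Q) + N * N * N * (t + z)
      ≤⟨ +-monoʳ-≤ (+ 64 * (N * N) * ((P + z - 1ℤ) * P + (Q + z - 1ℤ) * Q))
           (excess-bound (p + q) (p - q) t z (0≤+ (0≤+ 0≤P 0≤lit) (0≤+ 0≤Q 0≤lit)) 0≤t 0≤z 0≤n-288) ⟩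
    + 64 * (N * N) * ((P + z - 1ℤ) * P + (Q + z - 1ℤ) * Q) + + 8 * X
      ≡⟨ shift P Q z (N * N) X ⟩
    + 8 * (+ 8 * (N * N) * ((p - + 1) * (p + z - + 2) + (q - + 1) * (q + z - + 2)) + X)
      ≡⟨ cong (+ 8 *_) (sym (Φ-excess p q t z)) ⟩
    + 8 * (Φ N (q + t) + Φ N (p + t)) ∎
    where
    open ≤-Reasoning
    p q N X : ℤ
    p = P + 1ℤ
    q = Q + 1ℤ
    N = p + q + t + z
    X = excess N (p - q) (p + q + + 2 * z) t z
    shift : ∀ P Q z m X → + 64 * m * ((P + z - + 1) * P + (Q + z - + 1) * Q) + + 8 * X
      ≡ + 8 * (+ 8 * m * ((P + + 1 - + 1) * (P + + 1 + z - + 2) + (Q + + 1 - + 1) * (Q + + 1 + z - + 2)) + X)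
    shift = solve-∀

  -- The blowup joins x and y exactly if one of ax, ay is an edge. So xy is misjudged exactly if axy
  -- spans an odd number of edges, and the four terms are the cases of all three edges, only xy,
  -- only ax, only ay.
  parity-table : ∀ xy ax ay →
    ind (xy xor adj K₂ (if ax then 1F else 0F) (if ay then 1F else 0F))
      ≡ ind xy * (ind ax * ind ay) + ind xy * (ind (not ax) * ind (not ay))
        + ind ax * (ind (not xy) * ind (not ay)) + ind ay * (ind (not xy) * ind (not ax))
  parity-table true  true  true  = refl
  parity-table true  true  false = refl
  parity-table true  false true  = refl
  parity-table true  false false = refl
  parity-table false true  true  = refl
  parity-table false true  false = refl
  parity-table false false true  = refl
  parity-table false false false = refl

  argmin : 0 ℕ.< n → (f : Fin n → ℤ) → ∃[ a ] ∀ x → f a ≤ f x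
  argmin {1}                   _ f = 0F , λ { 0F → ≤-refl }
  argmin {ℕ.suc (ℕ.suc n)} _ f with argmin (ℕ.s≤s z≤n) (f ∘ suc)
  ... | a , f[a]≤ with ≤-total (f 0F) (f (suc a))
  ...   | inj₁ f0≤fa = 0F , λ { 0F → ≤-refl ; (suc x) → ≤-trans f0≤fa (f[a]≤ x) }
  ...   | inj₂ fa≤f0 = suc a , λ { 0F → fa≤f0 ; (suc x) → f[a]≤ x }

  module UpperBound (G : Graph n) where
    open Counting G

    N O : ℤ
    N = + n
    O = sum₂ λ a b → e a b * (t a b + z a b)

    X : Fin n → Fin n → ℤ
    X a b = (codeg a - 1ℤ) * P a b

    -- The factor `e a b` extends the bound to all pairs. The terms of the second endpoint carry
    -- `e b a` instead, so that exchanging the summations turns their sums into those of the first.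
    edge-bound′ : 0ℤ ≤ N - + 288 → ∀ a b →
      + 64 * (N * N) * (e a b * X a b) + + 64 * (N * N) * (e b a * X b a) + N * N * N * (e a b * (t a b + z a b))
        ≤ + 8 * (e a b * Φ N (deg a)) + + 8 * (e b a * Φ N (deg b))
    edge-bound′ 0≤N-288 a b = subst
      (λ s → + 64 * (N * N) * (e a b * X a b) + + 64 * (N * N) * (s * X b a) + N * N * N * (e a b * (t a b + z a b))
        ≤ + 8 * (e a b * Φ N (deg a)) + + 8 * (s * Φ N (deg b))) (e-sym a b)
      (subst₂ _≤_ (lhs (e a b) (+ 64 * (N * N)) (X a b) (X b a) (N * N * N) (t a b + z a b)) (rhs (e a b) (Φ N (deg a)) (Φ N (deg b)))
        (weighted (adj G a b) refl))
      where
      lhs : ∀ e m x y k s → e * (m * (x + y) + k * s) ≡ m * (e * x) + m * (e * y) + k * (e * s)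
      lhs = solve-∀
      rhs : ∀ e x y → e * (+ 8 * (x + y)) ≡ + 8 * (e * x) + + 8 * (e * y)
      rhs = solve-∀
      reorder : ∀ P Q t z → t + Q + 1ℤ + (P + z) + 1ℤ ≡ (P + 1ℤ) + (Q + 1ℤ) + t + z
      reorder = solve-∀
      reorder₂ : ∀ Q t → t + Q + 1ℤ ≡ Q + 1ℤ + t
      reorder₂ = solve-∀

      weighted : ∀ b₀ → adj G a b ≡ b₀ →
        ind b₀ * (+ 64 * (N * N) * (X a b + X b a) + N * N * N * (t a b + z a b)) ≤ ind b₀ * (+ 8 * (Φ N (deg a) + Φ N (deg b)))
      weighted false _  = ≤-refl
      weighted true  ab = *-monoˡ-≤-nonNeg 1ℤ (edge-bound (0≤P a b) (0≤P b a) (0≤t a b) (0≤z a b) 0≤N-288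
          deg-a deg-b codeg-a codeg-b order)
        where
        eab : e a b ≡ 1ℤ
        eab = cong ind ab
        hab : h a b ≡ 0ℤ
        hab = cong (λ c → ind (not c ∧ _)) ab
        deg-a′ : deg a ≡ t a b + P b a + 1ℤ
        deg-a′ = trans (deg-split b a) (cong₂ (λ u v → u + P b a + v) (t-sym b a) eab)
        deg-a : deg a ≡ P b a + 1ℤ + t a b
        deg-a = trans deg-a′ (reorder₂ (P b a) (t a b))
        deg-b : deg b ≡ P a b + 1ℤ + t a b
        deg-b = trans (trans (deg-split a b) (cong (λ v → t a b + P a b + v) (trans (e-sym b a) eab))) (reorder₂ (P a b) (t a b))
        codeg-a : codeg a ≡ P a b + z a b
        codeg-a = trans (codeg-split a b) (trans (cong (λ v → P a b + z a b + v) hab) (+-identityʳ _))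
        codeg-b : codeg b ≡ P b a + z a b
        codeg-b = trans (codeg-split b a) (trans (cong₂ (λ u v → P b a + u + v) (z-sym b a) (trans (h-sym b a) hab)) (+-identityʳ _))
        order : N ≡ (P a b + 1ℤ) + (P b a + 1ℤ) + t a b + z a b
        order = trans (order-split a) (trans (cong₂ (λ u v → u + v + 1ℤ) deg-a′ codeg-a) (reorder (P a b) (P b a) (t a b) (z a b)))

    deg≤n : ∀ a → 0ℤ ≤ N - deg a
    deg≤n a = subst (λ m → 0ℤ ≤ m - deg a) (sym (order-split a)) (subst (0ℤ ≤_) (identity (deg a) (codeg a))
       (0≤+ (0≤sum λ x → 0≤ind (nonadj a x)) (0≤lit {1})))
      where
      identity : ∀ d c → c + 1ℤ ≡ d + c + 1ℤ - d
      identity = solve-∀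

    -- Each vertex is counted as often as its degree, which is why Φ has to be bounded through x
    -- Φ(x).
    sum-degΦ : (sum₂ λ a b → e a b * Φ N (deg a)) ≤ N * (N * (A N * A N))
    sum-degΦ = begin
      (sum₂ λ a b → e a b * Φ N (deg a)) ≡⟨ sum-cong-≗ (λ a → sym (*-distribʳ-sum (Φ N (deg a)) (e a))) ⟩
      (sum λ a → deg a * Φ N (deg a))    ≤⟨ sum-mono (λ a → xΦ≤nA² N (deg a) (deg≤n a)) ⟩
      (sum {n} λ _ → N * (A N * A N))    ≡⟨ sum-const n (N * (A N * A N)) ⟩
      N * (N * (A N * A N)) ∎
      where open ≤-Reasoning

    sum₂-linear₃ : ∀ i j k (f g l : Fin n → Fin n → ℤ) →
      sum₂ (λ x y → i * f x y + j * g x y + k * l x y) ≡ i * sum₂ f + j * sum₂ g + k * sum₂ l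
    sum₂-linear₃ i j k f g l = trans (sum₂-+ (λ x y → i * f x y + j * g x y) (λ x y → k * l x y))
      (cong₂ _+_ (trans (sum₂-+ (λ x y → i * f x y) (λ x y → j * g x y)) (cong₂ _+_ (sum₂-*ˡ i f) (sum₂-*ˡ j g))) (sum₂-*ˡ k l))

    Λ-bound : 0ℤ ≤ N - + 288 → + 128 * + Λ H₀ G + N * O ≤ + 16 * (A N * A N)
    Λ-bound 0≤N-288 = *-cancelˡ-≤-pos _ _ (N * N) {{positive 0<N²}} (begin
      N * N * (+ 128 * L + N * O)
        ≡⟨ lhs N L O ⟩
      + 64 * (N * N) * L + + 64 * (N * N) * L + N * N * N * O
        ≡⟨ cong₂ (λ u v → + 64 * (N * N) * u + + 64 * (N * N) * v + N * N * N * O) Λ-sum (trans Λ-sum (∑-comm λ a b → e a b * X a b)) ⟩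
      + 64 * (N * N) * sum₂ (λ a b → e a b * X a b) + + 64 * (N * N) * sum₂ (λ a b → e b a * X b a) + N * N * N * O
        ≡⟨ sym (sum₂-linear₃ (+ 64 * (N * N)) (+ 64 * (N * N)) (N * N * N)
             (λ a b → e a b * X a b) (λ a b → e b a * X b a) (λ a b → e a b * (t a b + z a b))) ⟩
      sum₂ (λ a b → + 64 * (N * N) * (e a b * X a b) + + 64 * (N * N) * (e b a * X b a) + N * N * N * (e a b * (t a b + z a b)))
        ≤⟨ sum₂-mono (edge-bound′ 0≤N-288) ⟩
      sum₂ (λ a b → + 8 * (e a b * Φ N (deg a)) + + 8 * (e b a * Φ N (deg b)))
        ≡⟨ trans (sum₂-+ (λ a b → + 8 * (e a b * Φ N (deg a))) (λ a b → + 8 * (e b a * Φ N (deg b))))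
             (cong₂ _+_ (sum₂-*ˡ (+ 8) λ a b → e a b * Φ N (deg a))
               (trans (sum₂-*ˡ (+ 8) λ a b → e b a * Φ N (deg b)) (cong (+ 8 *_) (∑-comm λ a b → e b a * Φ N (deg b))))) ⟩
      + 8 * F + + 8 * F
        ≤⟨ +-mono-≤ (*-monoˡ-≤-nonNeg (+ 8) sum-degΦ) (*-monoˡ-≤-nonNeg (+ 8) sum-degΦ) ⟩
      + 8 * (N * (N * (A N * A N))) + + 8 * (N * (N * (A N * A N)))
        ≡⟨ rhs N (A N * A N) ⟩
      N * N * (+ 16 * (A N * A N)) ∎)
      where
      open ≤-Reasoning
      L F : ℤ
      L = + Λ H₀ G
      F = sum₂ λ a b → e a b * Φ N (deg a)
      0<N² : 0ℤ < N * N
      0<N² = <-≤-trans {j = + 288 * + 288} (+<+ (ℕ.s≤s z≤n)) (≤-by _ (0≤* 0≤N-288 (0≤+ {N} {+ 288} 0≤lit 0≤lit)) (identity N))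
        where
        identity : ∀ N → N * N ≡ + 288 * + 288 + (N - + 288) * (N + + 288)
        identity = solve-∀
      lhs : ∀ N L O → N * N * (+ 128 * L + N * O) ≡ + 64 * (N * N) * L + + 64 * (N * N) * L + N * N * N * O
      lhs = solve-∀
      rhs : ∀ N B → + 8 * (N * (N * B)) + + 8 * (N * (N * B)) ≡ N * N * (+ 16 * B)
      rhs = solve-∀

    -- As graphs have no loops, `a` itself joins its non-neighbours in part `0F`, so no pair
    -- containing `a` is wrong.
    side : Fin n → Fin n → Fin 2
    side a x = if adj G a x then 1F else 0F

    wrong : Fin n → Fin n → Fin n → ℤ
    wrong a x y = ind (adj G x y xor adj K₂ (side a x) (side a y))

    -- The terms of `parity-table`, with `nonadj` for non-adjacency and the arguments ordered so
    -- that each is an edge times a product occurring in `t` or `z`; summing over the vertex off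
    -- that edge gives `t` or `z` at once.
    odd : Fin n → Fin n → Fin n → ℤ
    odd a x y = e x y * (e x a * e y a) + e x y * (h x a * h y a) + e a x * (h x y * h a y) + e a y * (h y x * h a x)

    0≤odd : ∀ a x y → 0ℤ ≤ odd a x y
    0≤odd a x y = 0≤+ (0≤+ (0≤+
      (0≤* (0≤e x y) (0≤* (0≤e x a) (0≤e y a)))
      (0≤* (0≤e x y) (0≤* (0≤h x a) (0≤h y a))))
      (0≤* (0≤e a x) (0≤* (0≤h x y) (0≤h a y))))
      (0≤* (0≤e a y) (0≤* (0≤h y x) (0≤h a x)))
      where
      0≤e : ∀ x y → 0ℤ ≤ e x y
      0≤e x y = 0≤ind (adj G x y)
      0≤h : ∀ x y → 0ℤ ≤ h x y
      0≤h x y = 0≤ind (nonadj x y)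

    h-≢ : ∀ {x y} → x ≢ y → h x y ≡ ind (not (adj G x y))
    h-≢ {x} {y} x≢y with adj G x y | x Fin.≟ y
    ... | _     | yes x≡y = contradiction x≡y x≢y
    ... | true  | no _ = refl
    ... | false | no _ = refl

    wrong-loop : ∀ a x → wrong a x x ≡ 0ℤ
    wrong-loop a x rewrite adj-irr G x | adj-irr K₂ (side a x) = refl

    wrong-centreˡ : ∀ a y → wrong a a y ≡ 0ℤ
    wrong-centreˡ a y rewrite adj-irr G a with adj G a y
    ... | true  = refl
    ... | false = refl

    wrong-centreʳ : ∀ a x → wrong a x a ≡ 0ℤ
    wrong-centreʳ a x rewrite adj-irr G a | adj-sym G x a with adj G a x
    ... | true  = refl
    ... | false = refl

    wrong≤odd : ∀ a x y → wrong a x y ≤ odd a x y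
    wrong≤odd a x y = cases (x Fin.≟ y) (x Fin.≟ a) (y Fin.≟ a)
      where
      vanishes : ∀ {i} → i ≡ 0ℤ → i ≤ odd a x y
      vanishes eq = subst (_≤ odd a x y) (sym eq) (0≤odd a x y)
      distinct : x ≢ y → x ≢ a → y ≢ a → wrong a x y ≡ odd a x y
      distinct x≢y x≢a y≢a = trans (parity-table (adj G x y) (adj G a x) (adj G a y)) (sym
        (cong₂ _+_ (cong₂ _+_ (cong₂ _+_
          (cong (e x y *_) (cong₂ _*_ (e-sym x a) (e-sym y a)))
          (cong (e x y *_) (cong₂ _*_ (trans (h-sym x a) hax) (trans (h-sym y a) hay))))
          (cong (e a x *_) (cong₂ _*_ hxy hay)))
          (cong (e a y *_) (cong₂ _*_ (trans (h-sym y x) hxy) hax))))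
        where
        hxy = h-≢ x≢y
        hax = h-≢ (x≢a ∘ sym)
        hay = h-≢ (y≢a ∘ sym)
      cases : Dec (x ≡ y) → Dec (x ≡ a) → Dec (y ≡ a) → wrong a x y ≤ odd a x y
      cases (yes x≡y) _         _         = vanishes (subst (λ y → wrong a x y ≡ 0ℤ) x≡y (wrong-loop a x))
      cases _         (yes x≡a) _         = vanishes (subst (λ x → wrong a x y ≡ 0ℤ) (sym x≡a) (wrong-centreˡ a y))
      cases _         _         (yes y≡a) = vanishes (subst (λ y → wrong a x y ≡ 0ℤ) (sym y≡a) (wrong-centreʳ a x))
      cases (no x≢y)  (no x≢a)  (no y≢a)  = ≤-reflexive (distinct x≢y x≢a y≢a)

    sum₃-rotate : (f : Fin n → Fin n → Fin n → ℤ) →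
      sum (λ a → sum₂ (f a)) ≡ sum₂ λ x y → sum λ a → f a x y
    sum₃-rotate f = trans (∑-comm λ a x → sum (f a x)) (sum-cong-≗ λ x → ∑-comm λ a y → f a x y)

    factor : (u : Fin n → Fin n → ℤ) (f g : Fin n → Fin n → ℤ) →
      (sum₂ λ x y → sum λ a → u x y * (f x a * g y a)) ≡ sum₂ λ x y → u x y * sum λ a → f x a * g y a
    factor u f g = sum₂-cong λ x y → sym (*-distribˡ-sum (u x y) λ a → f x a * g y a)

    -- A triple with a single edge is met with this edge as xy, as ax and as ay, which gives the sum
    -- of `z` three times. Triangles come from the first term only. `O` has both once, so two sums
    -- of `z` remain.
    sum-odd : sum (λ a → sum₂ (odd a)) ≡ O + + 2 * sum₂ (λ x y → e x y * z x y)
    sum-odd = begin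
      sum (λ a → sum₂ (odd a))
        ≡⟨ sum-cong-≗ (λ a → trans (sum₂-+ (λ x y → odd₁ a x y + odd₂ a x y + odd₃ a x y) (odd₄ a))
             (cong (_+ sum₂ (odd₄ a)) (trans (sum₂-+ (λ x y → odd₁ a x y + odd₂ a x y) (odd₃ a))
               (cong (_+ sum₂ (odd₃ a)) (sum₂-+ (odd₁ a) (odd₂ a)))))) ⟩
      sum (λ a → sum₂ (odd₁ a) + sum₂ (odd₂ a) + sum₂ (odd₃ a) + sum₂ (odd₄ a))
        ≡⟨ trans (∑-distrib-+ (λ a → sum₂ (odd₁ a) + sum₂ (odd₂ a) + sum₂ (odd₃ a)) (sum₂ ∘ odd₄))
             (cong (_+ sum (sum₂ ∘ odd₄)) (trans (∑-distrib-+ (λ a → sum₂ (odd₁ a) + sum₂ (odd₂ a)) (sum₂ ∘ odd₃))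
               (cong (_+ sum (sum₂ ∘ odd₃)) (∑-distrib-+ (sum₂ ∘ odd₁) (sum₂ ∘ odd₂))))) ⟩
      sum (sum₂ ∘ odd₁) + sum (sum₂ ∘ odd₂) + sum (sum₂ ∘ odd₃) + sum (sum₂ ∘ odd₄)
        ≡⟨ cong₂ _+_ (cong₂ _+_ (cong₂ _+_ triangles edges) edges′) edges″ ⟩
      E₁ + E₂ + E₂ + E₂
        ≡⟨ identity E₁ E₂ ⟩
      E₁ + E₂ + + 2 * E₂
        ≡⟨ cong (_+ + 2 * E₂) (sym (trans (sum₂-cong λ x y → *-distribˡ-+ (e x y) (t x y) (z x y))
             (sum₂-+ (λ x y → e x y * t x y) (λ x y → e x y * z x y)))) ⟩
      O + + 2 * E₂ ∎
      where
      open ≡-Reasoning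
      odd₁ odd₂ odd₃ odd₄ : Fin n → Fin n → Fin n → ℤ
      odd₁ a x y = e x y * (e x a * e y a)
      odd₂ a x y = e x y * (h x a * h y a)
      odd₃ a x y = e a x * (h x y * h a y)
      odd₄ a x y = e a y * (h y x * h a x)
      E₁ E₂ : ℤ
      E₁ = sum₂ λ x y → e x y * t x y
      E₂ = sum₂ λ x y → e x y * z x y
      identity : ∀ a b → a + b + b + b ≡ a + b + + 2 * b
      identity = solve-∀
      triangles : sum (sum₂ ∘ odd₁) ≡ E₁
      triangles = trans (sum₃-rotate odd₁) (trans (factor e e e) (sum₂-cong λ x y → cong (e x y *_) (t-sym y x)))
      edges : sum (sum₂ ∘ odd₂) ≡ E₂
      edges = trans (sum₃-rotate odd₂) (trans (factor e h h) (sum₂-cong λ x y → cong (e x y *_) (z-sym y x)))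
      edges′ : sum (sum₂ ∘ odd₃) ≡ E₂
      edges′ = sum₂-cong λ a x → sym (*-distribˡ-sum (e a x) λ y → h x y * h a y)
      edges″ : sum (sum₂ ∘ odd₄) ≡ E₂
      edges″ = trans (sum-cong-≗ λ a → ∑-comm (odd₄ a)) (sum₂-cong λ a y → sym (*-distribˡ-sum (e a y) λ x → h y x * h a x))

    sum-wrong≤3O : sum (λ a → sum₂ (wrong a)) ≤ + 3 * O
    sum-wrong≤3O = begin
      sum (λ a → sum₂ (wrong a)) ≤⟨ sum-mono (λ a → sum₂-mono (wrong≤odd a)) ⟩
      sum (λ a → sum₂ (odd a))   ≡⟨ sum-odd ⟩
      O + + 2 * sum₂ (λ x y → e x y * z x y)
        ≤⟨ +-monoʳ-≤ O (*-monoˡ-≤-nonNeg (+ 2) (sum₂-mono λ x y → ≤-by (e x y * t x y) (0≤* (0≤ind (adj G x y)) (0≤t x y))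
             (trans (*-distribˡ-+ (e x y) (t x y) (z x y)) (+-comm (e x y * t x y) _)))) ⟩
      O + + 2 * O                ≡⟨ identity O ⟩
      + 3 * O ∎
      where
      open ≤-Reasoning
      identity : ∀ O → O + + 2 * O ≡ + 3 * O
      identity = solve-∀

    -- The identity permutation is good enough. Passing from x < y to all ordered pairs gives away a
    -- factor of two.
    editDistance≤sum-wrong : ∀ a → + editDistance G (blowup K₂ (side a)) ≤ sum₂ (wrong a)
    editDistance≤sum-wrong a = begin
      + editDistance G B
        ≤⟨ +≤+ (editDistance≤ Perm.id G B) ⟩
      + ∣E image Perm.id G △E B ∣
        ≡⟨ length-filter (λ (x , y) → (x Fin.<? y) ×-dec T? (adj G x y xor adj B x y)) (cartesianProduct (allFin n) (allFin n)) ⟩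
      ∑ₗ (λ (x , y) → ind (does (x Fin.<? y) ∧ (adj G x y xor adj B x y))) (cartesianProduct (allFin n) (allFin n))
        ≡⟨ trans (∑ₗ-cartesianProductWith (λ (x , y) → ind (does (x Fin.<? y) ∧ (adj G x y xor adj B x y))) _,_ (allFin n) (allFin n))
             (trans (∑ₗ-tabulate (λ x → ∑ₗ (λ y → ind (does (x Fin.<? y) ∧ (adj G x y xor adj B x y))) (allFin n)) id)
               (sum-cong-≗ λ x → ∑ₗ-tabulate (λ y → ind (does (x Fin.<? y) ∧ (adj G x y xor adj B x y))) id)) ⟩
      sum₂ (λ x y → ind (does (x Fin.<? y) ∧ (adj G x y xor adj B x y)))
        ≤⟨ sum₂-mono (λ x y → ind-∧≤ (does (x Fin.<? y)) (adj G x y xor adj B x y)) ⟩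
      sum₂ (wrong a) ∎
      where
      open ≤-Reasoning
      B : Graph n
      B = blowup K₂ (side a)
      ind-∧≤ : ∀ b c → ind (b ∧ c) ≤ ind c
      ind-∧≤ true  c = ≤-refl
      ind-∧≤ false c = 0≤ind c

    -- For the best centre `a`, n times the number of wrong pairs is at most the sum over all
    -- centres, hence at most 3 O. Tripling `Λ-bound` gives 384 and 48.
    nearest-bipartite : 0ℤ ≤ N - + 288 →
      ∃[ c ] + 384 * + Λ H₀ G + N * N * + editDistance G (blowup K₂ c) ≤ + 48 * (A N * A N)
    nearest-bipartite 0≤N-288 = side a , (begin
      + 384 * L + N * N * + editDistance G (blowup K₂ (side a))
        ≤⟨ +-monoʳ-≤ (+ 384 * L) (*-monoˡ-≤-nonNeg (N * N) {{nonNegative (0≤² N)}} (editDistance≤sum-wrong a)) ⟩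
      + 384 * L + N * N * W
        ≡⟨ cong (λ s → + 384 * L + s) (*-assoc N N W) ⟩
      + 384 * L + N * (N * W)
        ≡⟨ cong (λ s → + 384 * L + N * s) (sym (sum-const n W)) ⟩
      + 384 * L + N * sum {n} (λ _ → W)
        ≤⟨ +-monoʳ-≤ (+ 384 * L) (*-monoˡ-≤-nonNeg N (≤-trans (sum-mono minimal) sum-wrong≤3O)) ⟩
      + 384 * L + N * (+ 3 * O)
        ≡⟨ triple L N O ⟩
      + 3 * (+ 128 * L + N * O)
        ≤⟨ *-monoˡ-≤-nonNeg (+ 3) (Λ-bound 0≤N-288) ⟩
      + 3 * (+ 16 * (A N * A N))
        ≡⟨ sym (*-assoc (+ 3) (+ 16) (A N * A N)) ⟩
      + 48 * (A N * A N) ∎)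
      where
      open ≤-Reasoning
      n>0 : 0 ℕ.< n
      n>0 = drop‿+<+ (<-≤-trans {j = + 288} (+<+ (ℕ.s≤s z≤n)) (0≤i-j⇒j≤i 0≤N-288))
      best : ∃[ a ] ∀ x → sum₂ (wrong a) ≤ sum₂ (wrong x)
      best = argmin n>0 λ a → sum₂ (wrong a)
      a : Fin n
      a = proj₁ best
      minimal : ∀ x → sum₂ (wrong a) ≤ sum₂ (wrong x)
      minimal = proj₂ best
      L W : ℤ
      L = + Λ H₀ G
      W = sum₂ (wrong a)
      triple : ∀ L N O → + 384 * L + N * (+ 3 * O) ≡ + 3 * (+ 128 * L + N * O)
      triple = solve-∀

  -- Complete bipartite graphs

  in₀ in₁ : Fin 2 → ℤ
  in₀ i = ind (does (i Fin.≟ 0F))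
  in₁ i = ind (does (i Fin.≟ 1F))

  in₀+in₁≡1 : ∀ i → in₀ i + in₁ i ≡ 1ℤ
  in₀+in₁≡1 0F = refl
  in₀+in₁≡1 1F = refl

  ind-K₂ : ∀ i j → ind (adj K₂ i j) ≡ in₀ i * in₁ j + in₁ i * in₀ j
  ind-K₂ 0F 0F = refl
  ind-K₂ 0F 1F = refl
  ind-K₂ 1F 0F = refl
  ind-K₂ 1F 1F = refl

  +partSize : (c : Fin n → Fin 2) (i : Fin 2) → + partSize c i ≡ sum λ x → ind (does (c x Fin.≟ i))
  +partSize {n} c i = trans (length-filter (λ x → c x Fin.≟ i) (allFin n)) (∑ₗ-tabulate (λ x → ind (does (c x Fin.≟ i))) id)

  module Bipartite (c : Fin n → Fin 2) where
    open Counting (blowup K₂ c)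

    N p q : ℤ
    N = + n
    p = + partSize c 0F
    q = + partSize c 1F

    p+q≡N : p + q ≡ N
    p+q≡N = begin
      p + q                                ≡⟨ cong₂ _+_ (+partSize c 0F) (+partSize c 1F) ⟩
      sum (in₀ ∘ c) + sum (in₁ ∘ c)        ≡⟨ sym (∑-distrib-+ (in₀ ∘ c) (in₁ ∘ c)) ⟩
      sum (λ x → in₀ (c x) + in₁ (c x))    ≡⟨ sum-cong-≗ (in₀+in₁≡1 ∘ c) ⟩
      sum {n} (λ _ → 1ℤ)                   ≡⟨ trans (sum-const n 1ℤ) (*-identityʳ N) ⟩
      N ∎
      where open ≡-Reasoning

    deg-bipartite : ∀ x → deg x ≡ in₀ (c x) * q + in₁ (c x) * p
    deg-bipartite x = begin
      deg x
        ≡⟨ sum-cong-≗ (λ y → ind-K₂ (c x) (c y)) ⟩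
      sum (λ y → in₀ (c x) * in₁ (c y) + in₁ (c x) * in₀ (c y))
        ≡⟨ ∑-distrib-+ (λ y → in₀ (c x) * in₁ (c y)) (λ y → in₁ (c x) * in₀ (c y)) ⟩
      sum (λ y → in₀ (c x) * in₁ (c y)) + sum (λ y → in₁ (c x) * in₀ (c y))
        ≡⟨ sym (cong₂ _+_ (*-distribˡ-sum (in₀ (c x)) (in₁ ∘ c)) (*-distribˡ-sum (in₁ (c x)) (in₀ ∘ c))) ⟩
      in₀ (c x) * sum (in₁ ∘ c) + in₁ (c x) * sum (in₀ ∘ c)
        ≡⟨ sym (cong₂ (λ u v → in₀ (c x) * u + in₁ (c x) * v) (+partSize c 1F) (+partSize c 0F)) ⟩
      in₀ (c x) * q + in₁ (c x) * p ∎
      where open ≡-Reasoning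

    no-triangle : ∀ i j k → adj K₂ i j ≡ true → ind (adj K₂ j k) * ind (adj K₂ i k) ≡ 0ℤ
    no-triangle 0F 1F 0F _ = refl
    no-triangle 0F 1F 1F _ = refl
    no-triangle 1F 0F 0F _ = refl
    no-triangle 1F 0F 1F _ = refl
    no-triangle 1F 1F _ ()

    t≡0 : ∀ a b → adj K₂ (c a) (c b) ≡ true → t a b ≡ 0ℤ
    t≡0 a b ab = trans (sum-cong-≗ λ x → no-triangle (c a) (c b) (c x) ab) (trans (sum-const n 0ℤ) (*-zeroʳ N))

    -- Without triangles every neighbour of `b` other than `a` is a non-neighbour of `a`, so `P a b`
    -- is deg b - 1.
    cherries : ∀ a b u v → adj K₂ (c a) (c b) ≡ true → deg a ≡ u → deg b ≡ v →
      (codeg a - 1ℤ) * P a b ≡ (N - u - + 2) * (v - 1ℤ)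
    cherries a b u v ab refl refl = cong₂ _*_
      (trans (codeg-shift (deg a) (codeg a)) (cong (λ m → m - deg a - + 2) (sym (order-split a))))
      (trans (P-shift (P a b)) (cong (_- 1ℤ) (sym (trans (deg-split a b)
        (cong₂ (λ u v → u + P a b + v) (t≡0 a b ab) (trans (e-sym b a) (cong ind ab)))))))
      where
      codeg-shift : ∀ d c → c - 1ℤ ≡ d + c + 1ℤ - d - + 2
      codeg-shift = solve-∀
      P-shift : ∀ P → P ≡ 0ℤ + P + 1ℤ - 1ℤ
      P-shift = solve-∀

    -- If `a` lies in the part of size p, then deg a = q and deg b = p, so both factors are
    -- expressed by the size of the part of `a`.
    cherries-at : ∀ a b → e a b * ((codeg a - 1ℤ) * P a b)
      ≡ (p - + 2) * (p - 1ℤ) * (in₀ (c a) * in₁ (c b)) + (q - + 2) * (q - 1ℤ) * (in₁ (c a) * in₀ (c b))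
    cherries-at a b = cases (c a) (c b) refl refl
      where
      deg≡ : ∀ x i → c x ≡ i → deg x ≡ in₀ i * q + in₁ i * p
      deg≡ x i eq = trans (deg-bipartite x) (cong (λ i → in₀ i * q + in₁ i * p) eq)
      value₀ : ∀ p q n → 1ℤ * ((p + q - (1ℤ * q + 0ℤ * p) - + 2) * (0ℤ * q + 1ℤ * p - 1ℤ)) ≡ (p - + 2) * (p - 1ℤ) * 1ℤ + n * 0ℤ
      value₀ = solve-∀
      value₁ : ∀ p q n → 1ℤ * ((p + q - (0ℤ * q + 1ℤ * p) - + 2) * (1ℤ * q + 0ℤ * p - 1ℤ)) ≡ n * 0ℤ + (q - + 2) * (q - 1ℤ) * 1ℤ
      value₁ = solve-∀
      vanish : ∀ k l → 0ℤ ≡ k * 0ℤ + l * 0ℤ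
      vanish = solve-∀
      goal : Fin 2 → Fin 2 → Set
      goal i j = ind (adj K₂ i j) * ((codeg a - 1ℤ) * P a b)
        ≡ (p - + 2) * (p - 1ℤ) * (in₀ i * in₁ j) + (q - + 2) * (q - 1ℤ) * (in₁ i * in₀ j)
      cherries′ : ∀ i j → c a ≡ i → c b ≡ j → adj K₂ i j ≡ true →
        (codeg a - 1ℤ) * P a b ≡ (p + q - (in₀ i * q + in₁ i * p) - + 2) * (in₀ j * q + in₁ j * p - 1ℤ)
      cherries′ i j ca cb ij = trans (cherries a b _ _ (trans (cong₂ (adj K₂) ca cb) ij) (deg≡ a i ca) (deg≡ b j cb))
        (cong (λ m → (m - (in₀ i * q + in₁ i * p) - + 2) * (in₀ j * q + in₁ j * p - 1ℤ)) (sym p+q≡N))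
      cases′ : ∀ i j → c a ≡ i → c b ≡ j → goal i j
      cases′ 0F 0F _ _ = vanish ((p - + 2) * (p - 1ℤ)) ((q - + 2) * (q - 1ℤ))
      cases′ 1F 1F _ _ = vanish ((p - + 2) * (p - 1ℤ)) ((q - + 2) * (q - 1ℤ))
      cases′ 0F 1F ca cb = trans (cong (1ℤ *_) (cherries′ 0F 1F ca cb refl)) (value₀ p q ((q - + 2) * (q - 1ℤ)))
      cases′ 1F 0F ca cb = trans (cong (1ℤ *_) (cherries′ 1F 0F ca cb refl)) (value₁ p q ((p - + 2) * (p - 1ℤ)))
      cases : ∀ i j → c a ≡ i → c b ≡ j → goal (c a) (c b)
      cases i j ca cb = subst₂ goal (sym ca) (sym cb) (cases′ i j ca cb)

    sum₂-product : (f g : Fin n → ℤ) → sum₂ (λ x y → f x * g y) ≡ sum f * sum g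
    sum₂-product f g = trans (sum-cong-≗ λ x → sym (*-distribˡ-sum (f x) g)) (sym (*-distribʳ-sum (sum g) f))

    -- With n = p + q and m = p q the bracket is p² + q² - 3n + 4 = A n - 2m; this is where `A`
    -- comes from.
    Λ-bipartite : + Λ H₀ (blowup K₂ c) ≡ p * q * ((p - + 2) * (p - 1ℤ) + (q - + 2) * (q - 1ℤ))
    Λ-bipartite = begin
      + Λ H₀ (blowup K₂ c)
        ≡⟨ Λ-sum ⟩
      sum₂ (λ a b → e a b * ((codeg a - 1ℤ) * P a b))
        ≡⟨ sum₂-cong cherries-at ⟩
      sum₂ (λ a b → cherries₀ * (in₀ (c a) * in₁ (c b)) + cherries₁ * (in₁ (c a) * in₀ (c b)))
        ≡⟨ trans (sum₂-+ (λ a b → cherries₀ * (in₀ (c a) * in₁ (c b))) (λ a b → cherries₁ * (in₁ (c a) * in₀ (c b))))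
             (cong₂ _+_ (sum₂-*ˡ cherries₀ λ a b → in₀ (c a) * in₁ (c b)) (sum₂-*ˡ cherries₁ λ a b → in₁ (c a) * in₀ (c b))) ⟩
      cherries₀ * sum₂ (λ a b → in₀ (c a) * in₁ (c b)) + cherries₁ * sum₂ (λ a b → in₁ (c a) * in₀ (c b))
        ≡⟨ cong₂ (λ u v → cherries₀ * u + cherries₁ * v)
             (trans (sum₂-product (in₀ ∘ c) (in₁ ∘ c)) (sym (cong₂ _*_ (+partSize c 0F) (+partSize c 1F))))
             (trans (sum₂-product (in₁ ∘ c) (in₀ ∘ c)) (sym (cong₂ _*_ (+partSize c 1F) (+partSize c 0F)))) ⟩
      cherries₀ * (p * q) + cherries₁ * (q * p)
        ≡⟨ collect cherries₀ cherries₁ p q ⟩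
      p * q * (cherries₀ + cherries₁) ∎
      where
      open ≡-Reasoning
      cherries₀ cherries₁ : ℤ
      cherries₀ = (p - + 2) * (p - 1ℤ)
      cherries₁ = (q - + 2) * (q - 1ℤ)
      collect : ∀ i j p q → i * (p * q) + j * (q * p) ≡ p * q * (i + j)
      collect = solve-∀

  -- Part sizes for the lower bound

  initial : ℕ → Fin n → Fin 2
  initial p x = if toℕ x <ᵇ p then 0F else 1F

  partSize-initial : ∀ {n} p → p ℕ.≤ n → + partSize (initial {n} p) 0F ≡ + p
  partSize-initial {n} p p≤n = trans (+partSize (initial {n} p) 0F) (count n p p≤n)
    where
    count : ∀ n p → p ℕ.≤ n → sum (λ (x : Fin n) → in₀ (initial p x)) ≡ + p
    count n         ℕ.zero    _         = trans (sum-const n 0ℤ) (*-zeroʳ (+ n))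
    count (ℕ.suc n) (ℕ.suc p) (ℕ.s≤s h) = cong (λ s → 1ℤ + s) (count n p h)

  √ : ∀ m → ∃[ r ] r ℕ.* r ℕ.≤ m × m ℕ.< ℕ.suc r ℕ.* ℕ.suc r
  √ ℕ.zero = 0 , z≤n , ℕ.s≤s z≤n
  √ (ℕ.suc m) with √ m
  ... | r , r²≤m , m<[1+r]² with ℕ.m≤n⇒m<n∨m≡n m<[1+r]²
  ...   | inj₁ 1+m<[1+r]² = r , ℕ.m≤n⇒m≤1+n r²≤m , 1+m<[1+r]²
  ...   | inj₂ 1+m≡[1+r]² = ℕ.suc r , ℕ.≤-reflexive (sym 1+m≡[1+r]²) ,
            subst (ℕ._< ℕ.suc (ℕ.suc r) ℕ.* ℕ.suc (ℕ.suc r)) (sym 1+m≡[1+r]²) (ℕ.*-mono-< (ℕ.n<1+n (ℕ.suc r)) (ℕ.n<1+n (ℕ.suc r)))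

  parity : ∀ m → ∃[ p ] (m ≡ p ℕ.+ p ⊎ m ≡ ℕ.suc (p ℕ.+ p))
  parity ℕ.zero = 0 , inj₁ refl
  parity (ℕ.suc m) with parity m
  ... | p , inj₁ even = p , inj₂ (cong ℕ.suc even)
  ... | p , inj₂ odd  = ℕ.suc p , inj₁ (cong ℕ.suc (trans odd (sym (ℕ.+-suc p p))))

  -- The parts will be p and p + ε, so ε must have the parity of n: it is r = ⌊√(3n)⌋ or r - 1,
  -- whence the 2 + ε in the upper estimate. From 3 ≤ n follows r² ≤ 3n ≤ n², so r ≤ n.
  unbalanced : ∀ n → 3 ℕ.≤ n → ∃[ p ] ∃[ ε ] n ≡ ε ℕ.+ (p ℕ.+ p) × ε ℕ.* ε ℕ.≤ 3 ℕ.* n × 3 ℕ.* n ℕ.< (2 ℕ.+ ε) ℕ.* (2 ℕ.+ ε)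
  unbalanced n 3≤n with √ (3 ℕ.* n)
  ... | r , r²≤ , <[1+r]² with r ℕ.≤? n
  ...   | no r≰n = contradiction (ℕ.≤-<-trans (ℕ.*-monoˡ-≤ n 3≤n)
            (ℕ.<-≤-trans (ℕ.*-mono-< (ℕ.≰⇒> r≰n) (ℕ.≰⇒> r≰n)) r²≤)) (ℕ.<-irrefl refl)
  ...   | yes r≤n with parity (n ℕ.∸ r)
  ...     | p , inj₁ even = p , r , trans (sym (ℕ.m+[n∸m]≡n r≤n)) (cong (r ℕ.+_) even) , r²≤ ,
              ℕ.<-≤-trans <[1+r]² (ℕ.*-mono-≤ (ℕ.n≤1+n (ℕ.suc r)) (ℕ.n≤1+n (ℕ.suc r)))
  ...     | p , inj₂ odd with r
  ...       | ℕ.zero  = contradiction <[1+r]² (ℕ.≤⇒≯ (ℕ.≤-trans (ℕ.s≤s z≤n) (ℕ.*-monoʳ-≤ 3 3≤n)))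
  ...       | ℕ.suc ε = ℕ.suc p , ε , trans (sym (ℕ.m+[n∸m]≡n r≤n)) (trans (cong (ℕ.suc ε ℕ.+_) odd) (rearrange ε p)) ,
              ℕ.≤-trans (ℕ.*-mono-≤ (ℕ.n≤1+n ε) (ℕ.n≤1+n ε)) r²≤ , <[1+r]²
    where
    rearrange : ∀ ε p → ℕ.suc ε ℕ.+ ℕ.suc (p ℕ.+ p) ≡ ε ℕ.+ (ℕ.suc p ℕ.+ ℕ.suc p)
    rearrange = ℕ.solve-∀

  -- Writing g = ε² − 3n + 4, one has 8 Λ = A² − g² and |g| ≤ 4 (ε + 1).
  unbalanced-bound : ∀ p ε {n q L} → 0ℤ ≤ ε → n ≡ ε + (p + p) → q ≡ ε + p → L ≡ p * q * ((p - + 2) * (p - 1ℤ) + (q - + 2) * (q - 1ℤ)) →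
    0ℤ ≤ n - + 10000 → 0ℤ ≤ n → 0ℤ ≤ + 3 * n - ε * ε → 0ℤ ≤ (+ 2 + ε) * (+ 2 + ε) - (1ℤ + + 3 * n) →
    + 96 * (A n * A n) ≤ + 768 * L + n * n
  unbalanced-bound p ε {n} 0≤ε refl refl refl n≥10⁴ 0≤n ε²≤3n 3n<[2+ε]² = ≤-by _
    (0≤+ (0≤+ (0≤+ (0≤+ (0≤+
      (0≤* (0≤lit {96}) (0≤* below above))
      (0≤* (0≤lit {1536}) (0≤² (ε - 1ℤ))))
      (0≤* (0≤lit {3072}) ε²≤3n))
      (0≤* 0≤n n≥10⁴))
      (0≤* (0≤lit {784}) n≥10⁴))
      (0≤lit {7836928}))
    (identity p ε)
    where
    g : ℤ
    g = ε * ε - + 3 * n + + 4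
    below : 0ℤ ≤ + 4 * (ε + 1ℤ) - g
    below = subst (0ℤ ≤_) (rearrange ε (+ 3 * n)) (0≤+ (0≤* (0≤lit {4}) 0≤ε) ε²≤3n)
      where
      rearrange : ∀ E m → + 4 * E + (m - E * E) ≡ + 4 * (E + 1ℤ) - (E * E - m + + 4)
      rearrange = solve-∀
    above : 0ℤ ≤ + 4 * (ε + 1ℤ) + g
    above = subst (0ℤ ≤_) (rearrange ε (+ 3 * n)) (0≤+ 3n<[2+ε]² (0≤lit {5}))
      where
      rearrange : ∀ E m → (+ 2 + E) * (+ 2 + E) - (1ℤ + m) + + 5 ≡ + 4 * (E + 1ℤ) + (E * E - m + + 4)
      rearrange = solve-∀
    identity : ∀ p E → let M = E + (p + p) ; q = E + p ; A = M * M - + 3 * M + + 4 ; g = E * E - + 3 * M + + 4 in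
      + 768 * (p * q * ((p - + 2) * (p - 1ℤ) + (q - + 2) * (q - 1ℤ))) + M * M
        ≡ + 96 * (A * A) + (+ 96 * ((+ 4 * (E + 1ℤ) - g) * (+ 4 * (E + 1ℤ) + g)) + + 1536 * ((E - 1ℤ) * (E - 1ℤ))
          + + 3072 * (+ 3 * M - E * E) + M * (M - + 10000) + + 784 * (M - + 10000) + + 7836928)
    identity = solve-∀

  -- With g = ε² - 3n + 4 the loss 96 g² is at most 1536 (ε + 1)² ≤ 9216 n + 3072, which is below n²
  -- from n = 9217 on; 10000 is a round number above this.
  nearly-extremal : ∀ n → 10000 ℕ.≤ n →
    ∃[ c ] + 96 * (A (+ n) * A (+ n)) ≤ + 768 * + Λ H₀ (blowup {n = n} K₂ c) + + n * + n
  nearly-extremal n n≥10⁴ = from (unbalanced n (ℕ.≤-trans (ℕ.s≤s (ℕ.s≤s (ℕ.s≤s z≤n))) n≥10⁴))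
    where
    from : ∃[ p ] ∃[ ε ] n ≡ ε ℕ.+ (p ℕ.+ p) × ε ℕ.* ε ℕ.≤ 3 ℕ.* n × 3 ℕ.* n ℕ.< (2 ℕ.+ ε) ℕ.* (2 ℕ.+ ε) →
      ∃[ c ] + 96 * (A (+ n) * A (+ n)) ≤ + 768 * + Λ H₀ (blowup {n = n} K₂ c) + + n * + n
    from (p , ε , n≡ε+2p , ε²≤3n , 3n<[2+ε]²) = c ,
      unbalanced-bound (+ p) (+ ε) {+ n} {+ partSize c 1F} {+ Λ H₀ (blowup K₂ c)} 0≤lit N≡ part₁ count
        (i≤j⇒0≤j-i {+ 10000} {+ n} (+≤+ n≥10⁴)) 0≤lit
        (i≤j⇒0≤j-i {+ ε * + ε} {+ 3 * + n} lower)
        (i≤j⇒0≤j-i {1ℤ + + 3 * + n} {(+ 2 + + ε) * (+ 2 + + ε)} upper)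
      where
      lower : + ε * + ε ≤ + 3 * + n
      lower = subst₂ _≤_ (pos-* ε ε) (pos-* 3 n) (+≤+ ε²≤3n)
      upper : 1ℤ + + 3 * + n ≤ (+ 2 + + ε) * (+ 2 + + ε)
      upper = subst₂ _≤_ (cong (λ s → 1ℤ + s) (pos-* 3 n)) (pos-* (2 ℕ.+ ε) (2 ℕ.+ ε)) (+≤+ 3n<[2+ε]²)
      c : Fin n → Fin 2
      c = initial p
      N≡ : + n ≡ + ε + (+ p + + p)
      N≡ = trans (cong +_ n≡ε+2p) (trans (pos-+ ε _) (cong (λ s → + ε + s) (pos-+ p p)))
      part₀ : + partSize c 0F ≡ + p
      part₀ = partSize-initial p (subst (p ℕ.≤_) (sym n≡ε+2p) (ℕ.≤-trans (ℕ.m≤m+n p p) (ℕ.m≤n+m (p ℕ.+ p) ε)))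
      part₁ : + partSize c 1F ≡ + ε + + p
      part₁ = complement (+ partSize c 0F) (+ partSize c 1F) (+ p) (+ ε) (trans (Bipartite.p+q≡N c) N≡) part₀
        where
        complement : ∀ x y p ε → x + y ≡ ε + (p + p) → x ≡ p → y ≡ ε + p
        complement x y p ε total refl = trans (difference x y) (trans (cong (_- x) total) (remaining ε x))
          where
          difference : ∀ x y → y ≡ x + y - x
          difference = solve-∀
          remaining : ∀ E p → E + (p + p) - p ≡ E + p
          remaining = solve-∀
      count : + Λ H₀ (blowup K₂ c) ≡ + p * + partSize c 1F * ((+ p - + 2) * (+ p - 1ℤ) + (+ partSize c 1F - + 2) * (+ partSize c 1F - 1ℤ))
      count = trans (Bipartite.Λ-bipartite c)
        (cong (λ u → u * + partSize c 1F * ((u - + 2) * (u - 1ℤ) + (+ partSize c 1F - + 2) * (+ partSize c 1F - 1ℤ))) part₀)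

-- Densities, limits and the maximizer

open import Data.Nat.Combinatorics using (_P_)
open import Data.Rational.Base hiding (_/_; _⊔_)
open import Data.Rational.Properties
open import Data.Rational.Solver using (module +-*-Solver)
import Data.Rational.Unnormalised.Base as ℚᵘ
import Data.Rational.Unnormalised.Properties as ℚᵘ
open +-*-Solver using (solve; _:+_; _:*_; _:-_; :-_; _:=_; con)
open Integral using (A; module UpperBound; nearly-extremal; module Bipartite)

-- The integers inside the rationals

ι : ℤ → ℚ
ι i = i / 1

infix 9 #_
#_ : ℕ → ℚ
# m = + m / 1

-- A rational is stored in lowest terms. Equations are therefore checked on unnormalised fractions,
-- where equality is cross-multiplication.
toℚᵘ-/ : ∀ i d → toℚᵘ (i / ℕ.suc d) ℚᵘ.≃ ℚᵘ.mkℚᵘ i d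
toℚᵘ-/ i d = toℚᵘ-fromℚᵘ (ℚᵘ.mkℚᵘ i d)

ι-+ : ∀ i j → ι (i ℤ.+ j) ≡ ι i + ι j
ι-+ i j = toℚᵘ-injective (begin
  toℚᵘ (ι (i ℤ.+ j))              ≈⟨ toℚᵘ-/ (i ℤ.+ j) 0 ⟩
  ℚᵘ.mkℚᵘ (i ℤ.+ j) 0             ≈⟨ ℚᵘ.*≡* (identity i j) ⟩
  ℚᵘ.mkℚᵘ i 0 ℚᵘ.+ ℚᵘ.mkℚᵘ j 0    ≈⟨ ℚᵘ.+-cong (toℚᵘ-/ i 0) (toℚᵘ-/ j 0) ⟨
  toℚᵘ (ι i) ℚᵘ.+ toℚᵘ (ι j)      ≈⟨ toℚᵘ-homo-+ (ι i) (ι j) ⟨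
  toℚᵘ (ι i + ι j) ∎)
  where
  open ℚᵘ.≃-Reasoning
  identity : ∀ i j → (i ℤ.+ j) ℤ.* 1ℤ ≡ (i ℤ.* 1ℤ ℤ.+ j ℤ.* 1ℤ) ℤ.* 1ℤ
  identity = ℤ.solve-∀

ι-* : ∀ i j → ι (i ℤ.* j) ≡ ι i * ι j
ι-* i j = toℚᵘ-injective (begin
  toℚᵘ (ι (i ℤ.* j))              ≈⟨ toℚᵘ-/ (i ℤ.* j) 0 ⟩
  ℚᵘ.mkℚᵘ i 0 ℚᵘ.* ℚᵘ.mkℚᵘ j 0    ≈⟨ ℚᵘ.*-cong (toℚᵘ-/ i 0) (toℚᵘ-/ j 0) ⟨
  toℚᵘ (ι i) ℚᵘ.* toℚᵘ (ι j)      ≈⟨ toℚᵘ-homo-* (ι i) (ι j) ⟨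
  toℚᵘ (ι i * ι j) ∎)
  where open ℚᵘ.≃-Reasoning

ι-neg : ∀ i → ι (ℤ.- i) ≡ - ι i
ι-neg i = toℚᵘ-injective (begin
  toℚᵘ (ι (ℤ.- i))              ≈⟨ toℚᵘ-/ (ℤ.- i) 0 ⟩
  ℚᵘ.- ℚᵘ.mkℚᵘ i 0              ≈⟨ ℚᵘ.-‿cong (toℚᵘ-/ i 0) ⟨
  ℚᵘ.- toℚᵘ (ι i)               ≈⟨ toℚᵘ-homo‿- (ι i) ⟨
  toℚᵘ (- ι i) ∎)
  where open ℚᵘ.≃-Reasoning

ι-- : ∀ i j → ι (i ℤ.- j) ≡ ι i - ι j
ι-- i j = trans (ι-+ i (ℤ.- j)) (cong (λ s → ι i + s) (ι-neg j))

ι-mono-≤ : ∀ {i j} → i ℤ.≤ j → ι i ≤ ι j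
ι-mono-≤ {i} {j} i≤j = toℚᵘ-cancel-≤ (ℚᵘ.≤-respˡ-≃ (ℚᵘ.≃-sym (toℚᵘ-/ i 0)) (ℚᵘ.≤-respʳ-≃ (ℚᵘ.≃-sym (toℚᵘ-/ j 0))
  (ℚᵘ.*≤* (ℤ.*-monoʳ-≤-nonNeg 1ℤ i≤j))))

ι-cancel-≤ : ∀ {i j} → ι i ≤ ι j → i ℤ.≤ j
ι-cancel-≤ {i} {j} h = subst₂ ℤ._≤_ (ℤ.*-identityʳ i) (ℤ.*-identityʳ j)
  (ℚᵘ.drop-*≤* (ℚᵘ.≤-respˡ-≃ (toℚᵘ-/ i 0) (ℚᵘ.≤-respʳ-≃ (toℚᵘ-/ j 0) (toℚᵘ-mono-≤ h))))

/-*-cancel : ∀ i d .{{_ : ℕ.NonZero d}} → i / d * # d ≡ ι i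
/-*-cancel i (ℕ.suc d) = toℚᵘ-injective (begin
  toℚᵘ (i / ℕ.suc d * # ℕ.suc d)                  ≈⟨ toℚᵘ-homo-* (i / ℕ.suc d) (# ℕ.suc d) ⟩
  toℚᵘ (i / ℕ.suc d) ℚᵘ.* toℚᵘ (# ℕ.suc d)        ≈⟨ ℚᵘ.*-cong (toℚᵘ-/ i d) (toℚᵘ-/ (+ ℕ.suc d) 0) ⟩
  ℚᵘ.mkℚᵘ i d ℚᵘ.* ℚᵘ.mkℚᵘ (+ ℕ.suc d) 0          ≈⟨ ℚᵘ.*≡* num ⟩
  ℚᵘ.mkℚᵘ i 0                                     ≈⟨ toℚᵘ-/ i 0 ⟨
  toℚᵘ (ι i) ∎)
  where
  open ℚᵘ.≃-Reasoning
  num : i ℤ.* + ℕ.suc d ℤ.* 1ℤ ≡ i ℤ.* + (ℕ.suc d ℕ.* 1)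
  num = trans (ℤ.*-assoc i (+ ℕ.suc d) 1ℤ) (cong (i ℤ.*_) (sym (ℤ.pos-* (ℕ.suc d) 1)))

0≤# : ∀ {m} → 0ℚ ≤ # m
0≤# {m} = ι-mono-≤ {0ℤ} {+ m} (ℤ.+≤+ z≤n)

0≤+ : ∀ {x y} → 0ℚ ≤ x → 0ℚ ≤ y → 0ℚ ≤ x + y
0≤+ = +-mono-≤

0≤* : ∀ {x y} → 0ℚ ≤ x → 0ℚ ≤ y → 0ℚ ≤ x * y
0≤* {x} {y} 0≤x 0≤y = subst (_≤ x * y) (*-zeroʳ x) (*-monoˡ-≤-nonNeg x {{nonNegative 0≤x}} 0≤y)

x≤y⇒0≤y-x : ∀ {x y} → x ≤ y → 0ℚ ≤ y - x
x≤y⇒0≤y-x {x} {y} x≤y = subst (_≤ y - x) (+-inverseʳ x) (+-monoˡ-≤ (- x) x≤y)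

0≤y-x⇒x≤y : ∀ {x y} → 0ℚ ≤ y - x → x ≤ y
0≤y-x⇒x≤y {x} {y} h = subst₂ _≤_ (+-identityʳ x) (identity x y) (+-monoʳ-≤ x h)
  where
  identity : ∀ x y → x + (y - x) ≡ y
  identity = solve 2 (λ x y → x :+ (y :- x) := y) refl

0≤² : ∀ x → 0ℚ ≤ x * x
0≤² x with ≤-total 0ℚ x
... | inj₁ 0≤x = 0≤* 0≤x 0≤x
... | inj₂ x≤0 = subst (0ℚ ≤_) (identity x) (0≤* (neg-antimono-≤ x≤0) (neg-antimono-≤ x≤0))
  where
  identity : ∀ x → (- x) * (- x) ≡ x * x
  identity = solve 1 (λ x → (:- x) :* (:- x) := x :* x) refl

-- Inequalities are proved by exhibiting d (y − x), for some d > 0, as a sum of non-negative terms.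
≤-by : ∀ {x y} d s → 0ℚ < d → 0ℚ ≤ s → d * (y - x) ≡ s → x ≤ y
≤-by {x} {y} d s 0<d 0≤s eq = 0≤y-x⇒x≤y (*-cancelˡ-≤-pos d {{positive 0<d}} (subst₂ _≤_ (sym (*-zeroʳ d)) (sym eq) 0≤s))

#-cancel-≤ : ∀ {m n} → # m ≤ # n → m ℕ.≤ n
#-cancel-≤ h = ℤ.drop‿+≤+ (ι-cancel-≤ h)

0<1 : 0ℚ < 1ℚ
0<1 = positive⁻¹ 1ℚ

0<* : ∀ {x y} → 0ℚ < x → 0ℚ < y → 0ℚ < x * y
0<* {x} {y} 0<x 0<y = subst (_< x * y) (*-zeroʳ x) (*-monoʳ-<-pos x {{positive 0<x}} 0<y)

-- Falling factorials and inequalities for large n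

fall : ℚ → ℚ
fall n = (n - # 3) * ((n - # 2) * ((n - # 1) * n))

+nP4 : ∀ n → 4 ℕ.≤ n → + (n P 4) ≡ (+ n ℤ.- + 3) ℤ.* ((+ n ℤ.- + 2) ℤ.* ((+ n ℤ.- + 1) ℤ.* (+ n ℤ.* 1ℤ)))
+nP4 (ℕ.suc (ℕ.suc (ℕ.suc (ℕ.suc m)))) (ℕ.s≤s (ℕ.s≤s (ℕ.s≤s (ℕ.s≤s z≤n)))) =
  pos-*⁴ (1 ℕ.+ m) (2 ℕ.+ m) (3 ℕ.+ m) (4 ℕ.+ m)
  where
  pos-*⁴ : ∀ a b c d → + (a ℕ.* (b ℕ.* (c ℕ.* (d ℕ.* 1)))) ≡ + a ℤ.* (+ b ℤ.* (+ c ℤ.* (+ d ℤ.* 1ℤ)))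
  pos-*⁴ a b c d = trans (ℤ.pos-* a (b ℕ.* (c ℕ.* (d ℕ.* 1)))) (cong (+ a ℤ.*_)
    (trans (ℤ.pos-* b (c ℕ.* (d ℕ.* 1))) (cong (+ b ℤ.*_)
      (trans (ℤ.pos-* c (d ℕ.* 1)) (cong (+ c ℤ.*_) (ℤ.pos-* d 1))))))

#nP4 : ∀ n → 4 ℕ.≤ n → # (n P 4) ≡ fall (# n)
#nP4 n 4≤n = trans (cong ι (+nP4 n 4≤n)) (step (+ 3) (step (+ 2) (step (+ 1) (cong ι (ℤ.*-identityʳ (+ n))))))
  where
  step : ∀ j {k x} → ι k ≡ x → ι ((+ n ℤ.- j) ℤ.* k) ≡ (# n - ι j) * x
  step j {k} eq = trans (ι-* (+ n ℤ.- j) k) (cong₂ _*_ (ι-- (+ n) j) eq)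

¼ ⅛ : ℚ
¼ = + 1 / 4
⅛ = + 1 / 8

0≤½ : 0ℚ ≤ ½
0≤½ = nonNegative⁻¹ ½

0≤¼ : 0ℚ ≤ ¼
0≤¼ = nonNegative⁻¹ ¼

Aℚ : ℚ → ℚ
Aℚ n = n * n - # 3 * n + # 4

ι-A : ∀ i → ι (A i) ≡ Aℚ (ι i)
ι-A i = trans (ι-+ (i ℤ.* i ℤ.- + 3 ℤ.* i) (+ 4)) (cong (_+ # 4)
  (trans (ι-- (i ℤ.* i) (+ 3 ℤ.* i)) (cong₂ _-_ (ι-* i i) (ι-* (+ 3) i))))

module Large (n : ℚ) (n≥10⁴ : 0ℚ ≤ n - # 10000) where

  n>0 : 0ℚ < n
  n>0 = <-≤-trans (positive⁻¹ (# 10000)) (0≤y-x⇒x≤y n≥10⁴)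

  0≤n : 0ℚ ≤ n
  0≤n = <⇒≤ n>0

  0≤n³ : 0ℚ ≤ n * n * n
  0≤n³ = 0≤* (0≤² n) 0≤n

  n³≤fall : 0ℚ ≤ fall n - n * n * n
  n³≤fall = subst (0ℚ ≤_) (identity n) (0≤+ (0≤+ (0≤* 0≤n³ n≥10⁴) (0≤* (0≤# {9993}) 0≤n³))
    (0≤* 0≤n (0≤+ (0≤* (0≤# {11}) n≥10⁴) (0≤# {109994}))))
    where
    identity : ∀ n →
      n * n * n * (n - # 10000) + # 9993 * (n * n * n) + n * (# 11 * (n - # 10000) + # 109994)
      ≡ (n - # 3) * ((n - # 2) * ((n - # 1) * n)) - n * n * n
    identity = solve 1 (λ n →
      n :* n :* n :* (n :- con (# 10000)) :+ con (# 9993) :* (n :* n :* n) :+ n :* (con (# 11) :* (n :- con (# 10000)) :+ con (# 109994))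
      := (n :- con (# 3)) :* ((n :- con (# 2)) :* ((n :- con (# 1)) :* n)) :- n :* n :* n) refl

  fall>0 : 0ℚ < fall n
  fall>0 = <-≤-trans (0<* (0<* n>0 n>0) n>0) (0≤y-x⇒x≤y n³≤fall)

  fall≤n⁴ : 0ℚ ≤ n * n * (n * n) - fall n
  fall≤n⁴ = subst (0ℚ ≤_) (identity n) (0≤* 0≤n (0≤+ (0≤* 0≤n (0≤+ (0≤* (0≤# {6}) n≥10⁴) (0≤# {59989}))) (0≤# {6})))
    where
    identity : ∀ n →
      n * (n * (# 6 * (n - # 10000) + # 59989) + # 6)
      ≡ n * n * (n * n) - (n - # 3) * ((n - # 2) * ((n - # 1) * n))
    identity = solve 1 (λ n →
      n :* (n :* (con (# 6) :* (n :- con (# 10000)) :+ con (# 59989)) :+ con (# 6))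
      := n :* n :* (n :* n) :- (n :- con (# 3)) :* ((n :- con (# 2)) :* ((n :- con (# 1)) :* n))) refl

  n⁴≤2fall : 0ℚ ≤ fall n - ½ * (n * n * (n * n))
  n⁴≤2fall = subst (0ℚ ≤_) (identity n) (0≤* 0≤½ (0≤+ (0≤+ (0≤* 0≤n³ n≥10⁴) (0≤* (0≤# {9988}) 0≤n³))
    (0≤* 0≤n (0≤+ (0≤* (0≤# {22}) n≥10⁴) (0≤# {219988})))))
    where
    identity : ∀ n →
      ½ * (n * n * n * (n - # 10000) + # 9988 * (n * n * n) + n * (# 22 * (n - # 10000) + # 219988))
      ≡ (n - # 3) * ((n - # 2) * ((n - # 1) * n)) - ½ * (n * n * (n * n))
    identity = solve 1 (λ n →
      con ½ :* (n :* n :* n :* (n :- con (# 10000)) :+ con (# 9988) :* (n :* n :* n)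
        :+ n :* (con (# 22) :* (n :- con (# 10000)) :+ con (# 219988)))
      := (n :- con (# 3)) :* ((n :- con (# 2)) :* ((n :- con (# 1)) :* n)) :- con ½ :* (n :* n :* (n :* n))) refl

  -- A² and n (n - 1) (n - 2) (n - 3) agree in degrees four and three: their difference is 6 n² - 18
  -- n + 16. Hence A²/8 embeddings mean density 1/8 up to O(1/n²).
  A²≤fall+8n² : 0ℚ ≤ fall n + # 8 * (n * n) - Aℚ n * Aℚ n
  A²≤fall+8n² = subst (0ℚ ≤_) (identity n) (0≤+ (0≤+ (0≤* (0≤# {2}) (0≤² n)) (0≤* (0≤# {18}) n≥10⁴)) (0≤# {179984}))
    where
    identity : ∀ n →
      # 2 * (n * n) + # 18 * (n - # 10000) + # 179984
      ≡ (n - # 3) * ((n - # 2) * ((n - # 1) * n)) + # 8 * (n * n) - (n * n - # 3 * n + # 4) * (n * n - # 3 * n + # 4)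
    identity = solve 1 (λ n →
      con (# 2) :* (n :* n) :+ con (# 18) :* (n :- con (# 10000)) :+ con (# 179984)
      := (n :- con (# 3)) :* ((n :- con (# 2)) :* ((n :- con (# 1)) :* n)) :+ con (# 8) :* (n :* n)
        :- (n :* n :- con (# 3) :* n :+ con (# 4)) :* (n :* n :- con (# 3) :* n :+ con (# 4))) refl

  fall≤A² : 0ℚ ≤ Aℚ n * Aℚ n - fall n
  fall≤A² = subst (0ℚ ≤_) (identity n) (0≤+ (0≤+ (0≤* (0≤# {6}) (0≤* 0≤n n≥10⁴)) (0≤* (0≤# {59982}) 0≤n)) (0≤# {16}))
    where
    identity : ∀ n →
      # 6 * (n * (n - # 10000)) + # 59982 * n + # 16
      ≡ (n * n - # 3 * n + # 4) * (n * n - # 3 * n + # 4) - (n - # 3) * ((n - # 2) * ((n - # 1) * n))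
    identity = solve 1 (λ n →
      con (# 6) :* (n :* (n :- con (# 10000))) :+ con (# 59982) :* n :+ con (# 16)
      := (n :* n :- con (# 3) :* n :+ con (# 4)) :* (n :* n :- con (# 3) :* n :+ con (# 4))
        :- (n :- con (# 3)) :* ((n :- con (# 2)) :* ((n :- con (# 1)) :* n))) refl

  module _ (ρ e : ℚ) (upper : # 384 * (ρ * fall n) + n * n * e ≤ # 48 * (Aℚ n * Aℚ n)) (0≤e : 0ℚ ≤ e) where

    -- Replacing A² by `fall n` costs 48 · 8 n² = 384 n², and this is paid by 384 ε `fall n` ≥ 384 ε
    -- n³ ≥ 384 n².
    density≤ : ∀ ε → 0ℚ ≤ ε → 0ℚ ≤ ε * n - # 1 → ρ ≤ ⅛ + ε
    density≤ ε 0≤ε 1≤εn = ≤-by (# 384 * fall n) _ (0<* (positive⁻¹ (# 384)) fall>0)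
      (0≤+ (0≤+ (0≤+ (0≤+ (x≤y⇒0≤y-x upper) (0≤* (0≤² n) 0≤e)) (0≤* (0≤# {48}) A²≤fall+8n²))
        (0≤* (0≤# {384}) (0≤* 0≤ε n³≤fall))) (0≤* (0≤# {384}) (0≤* (0≤² n) 1≤εn)))
      (identity n (fall n) ρ e (Aℚ n * Aℚ n) ε)
      where
      identity : ∀ n D ρ e B ε →
        # 384 * D * (⅛ + ε - ρ)
        ≡ # 48 * B - (# 384 * (ρ * D) + n * n * e) + n * n * e + # 48 * (D + # 8 * (n * n) - B)
          + # 384 * (ε * (D - n * n * n)) + # 384 * (n * n * (ε * n - # 1))
      identity = solve 6 (λ n D ρ e B ε →
        con (# 384) :* D :* (con ⅛ :+ ε :- ρ)
        := con (# 48) :* B :- (con (# 384) :* (ρ :* D) :+ n :* n :* e) :+ n :* n :* e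
          :+ con (# 48) :* (D :+ con (# 8) :* (n :* n) :- B) :+ con (# 384) :* (ε :* (D :- n :* n :* n))
          :+ con (# 384) :* (n :* n :* (ε :* n :- con (# 1)))) refl

    -- Twice `upper` combined with `lower` gives 2 n² e ≤ 768 (μ - ρ) `fall n` + n². As an edit
    -- distance is an integer, e ≥ 1 unless e = 0, and one of the two copies of n² e absorbs the n².
    -- This leaves e ≤ 768 (M - ρ) n²; the constant is raised to 10000 because it is also the
    -- threshold for n.
    stability : ∀ μ M → # 96 * (Aℚ n * Aℚ n) ≤ # 768 * (μ * fall n) + n * n → μ ≤ M → ρ ≤ M → e ≡ 0ℚ ⊎ # 1 ≤ e →
      e ≤ # 10000 * (M - ρ) * (n * n)
    stability μ M lower μ≤M ρ≤M (inj₁ refl) = 0≤* (0≤* (0≤# {10000}) (x≤y⇒0≤y-x ρ≤M)) (0≤² n)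
    stability μ M lower μ≤M ρ≤M (inj₂ 1≤e) = ≤-by (n * n) _ (0<* n>0 n>0)
      (0≤+ (0≤+ (0≤+ (0≤+ (0≤+
        (0≤* (0≤# {768}) (0≤* (x≤y⇒0≤y-x ρ≤M) fall≤n⁴))
        (0≤* (0≤# {768}) (0≤* (x≤y⇒0≤y-x μ≤M) (<⇒≤ fall>0))))
        (x≤y⇒0≤y-x lower))
        (0≤* (0≤# {2}) (x≤y⇒0≤y-x upper)))
        (0≤* (0≤² n) (x≤y⇒0≤y-x 1≤e)))
        (0≤* (0≤# {9232}) (0≤* (x≤y⇒0≤y-x ρ≤M) (0≤² (n * n)))))
      (identity n (fall n) ρ e (Aℚ n * Aℚ n) μ M)
      where
      identity : ∀ n D ρ e B μ M →
        n * n * (# 10000 * (M - ρ) * (n * n) - e)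
        ≡ # 768 * ((M - ρ) * (n * n * (n * n) - D)) + # 768 * ((M - μ) * D) + (# 768 * (μ * D) + n * n - # 96 * B)
          + # 2 * (# 48 * B - (# 384 * (ρ * D) + n * n * e)) + n * n * (e - # 1)
          + # 9232 * ((M - ρ) * (n * n * (n * n)))
      identity = solve 7 (λ n D ρ e B μ M →
        n :* n :* (con (# 10000) :* (M :- ρ) :* (n :* n) :- e)
        := con (# 768) :* ((M :- ρ) :* (n :* n :* (n :* n) :- D)) :+ con (# 768) :* ((M :- μ) :* D)
          :+ (con (# 768) :* (μ :* D) :+ n :* n :- con (# 96) :* B)
          :+ con (# 2) :* (con (# 48) :* B :- (con (# 384) :* (ρ :* D) :+ n :* n :* e))
          :+ n :* n :* (e :- con (# 1)) :+ con (# 9232) :* ((M :- ρ) :* (n :* n :* (n :* n)))) refl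

  ⅛≤density : ∀ μ → # 96 * (Aℚ n * Aℚ n) ≤ # 768 * (μ * fall n) + n * n → ∀ ε → 0ℚ ≤ ε → 0ℚ ≤ ε * n - # 1 → ⅛ ≤ μ + ε
  ⅛≤density μ lower ε 0≤ε 1≤εn = ≤-by (# 768 * fall n) _ (0<* (positive⁻¹ (# 768)) fall>0)
    (0≤+ (0≤+ (0≤+ (0≤+ (x≤y⇒0≤y-x lower) (0≤* (0≤# {96}) fall≤A²)) (0≤* (0≤# {768}) (0≤* 0≤ε n³≤fall)))
      (0≤* (0≤# {768}) (0≤* (0≤² n) 1≤εn))) (0≤* (0≤# {767}) (0≤² n)))
    (identity n (fall n) μ (Aℚ n * Aℚ n) ε)
    where
    identity : ∀ n D μ B ε →
      # 768 * D * (μ + ε - ⅛)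
      ≡ # 768 * (μ * D) + n * n - # 96 * B + # 96 * (B - D) + # 768 * (ε * (D - n * n * n))
        + # 768 * (n * n * (ε * n - # 1)) + # 767 * (n * n)
    identity = solve 5 (λ n D μ B ε →
      con (# 768) :* D :* (μ :+ ε :- con ⅛)
      := con (# 768) :* (μ :* D) :+ n :* n :- con (# 96) :* B :+ con (# 96) :* (B :- D)
        :+ con (# 768) :* (ε :* (D :- n :* n :* n)) :+ con (# 768) :* (n :* n :* (ε :* n :- con (# 1)))
        :+ con (# 767) :* (n :* n)) refl

-- For a = (u, 1 − u) the sum defining λ(K₂(a)) is u (1 − u) (u² + (1 − u)²).
f : ℚ → ℚ
f u = u * (1ℚ - u) * (1ℚ - # 2 * (u * (1ℚ - u)))

-- With s = u - 1/2 one has f = (1/4 - s²) (1/2 + 2 s²), whose quadratic terms cancel. The fourth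
-- power gives both the maximum 1/8 and its uniqueness.
f-deficit : ∀ u → ⅛ ≡ f u + # 2 * ((u - ½) * (u - ½) * ((u - ½) * (u - ½)))
f-deficit = identity
  where
  identity : ∀ u →
    ⅛
    ≡ u * (# 1 - u) * (# 1 - # 2 * (u * (# 1 - u))) + # 2 * ((u - ½) * (u - ½) * ((u - ½) * (u - ½)))
  identity = solve 1 (λ u →
    con ⅛
    := u :* (con (# 1) :- u) :* (con (# 1) :- con (# 2) :* (u :* (con (# 1) :- u)))
      :+ con (# 2) :* ((u :- con ½) :* (u :- con ½) :* ((u :- con ½) :* (u :- con ½)))) refl

bipartite-count : ℚ → ℚ → ℚ
bipartite-count p q = p * q * ((p - # 2) * (p - # 1) + (q - # 2) * (q - # 1))

module _ (n : ℚ) (n≥10⁴ : 0ℚ ≤ n - # 10000) (u ρ : ℚ) (0≤u : 0ℚ ≤ u) (u≤1 : 0ℚ ≤ 1ℚ - u)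
  (count : ρ * fall n ≡ bipartite-count (u * n) ((1ℚ - u) * n)) where
  open Large n n≥10⁴

  private
    m : ℚ
    m = u * (1ℚ - u)

    0≤m : 0ℚ ≤ m
    0≤m = 0≤* 0≤u u≤1

    0≤f : 0ℚ ≤ f u
    0≤f = subst (0ℚ ≤_) (identity u) (0≤* 0≤m (0≤+ (0≤² u) (0≤² (1ℚ - u))))
      where
      identity : ∀ u →
        u * (# 1 - u) * (u * u + (# 1 - u) * (# 1 - u))
        ≡ u * (# 1 - u) * (# 1 - # 2 * (u * (# 1 - u)))
      identity = solve 1 (λ u →
        u :* (con (# 1) :- u) :* (u :* u :+ (con (# 1) :- u) :* (con (# 1) :- u))
        := u :* (con (# 1) :- u) :* (con (# 1) :- con (# 2) :* (u :* (con (# 1) :- u)))) refl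

    -- The expression equals ε `fall n` - n³: the tolerance ε pays for the terms of order n³ by
    -- which the count differs from `f u * fall n`.
    main-term : ∀ ε → 0ℚ ≤ ε → 0ℚ ≤ ε * n - # 2 →
      0ℚ ≤ ε * (fall n - ½ * (n * n * (n * n))) + ½ * (n * n * n * (ε * n - # 2))
    main-term ε 0≤ε 2≤εn = 0≤+ (0≤* 0≤ε n⁴≤2fall) (0≤* 0≤½ (0≤* 0≤n³ 2≤εn))

  bipartite-density≤ : ∀ ε → 0ℚ ≤ ε → 0ℚ ≤ ε * n - # 2 → ρ ≤ f u + ε
  bipartite-density≤ ε 0≤ε 2≤εn = ≤-by (fall n) _ fall>0
    (0≤+ (0≤+ (0≤+ (main-term ε 0≤ε 2≤εn)
      (0≤* 0≤n³ (0≤+ 0≤¼ (0≤* (0≤# {12}) (0≤² (m - ¼))))))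
      (0≤* 0≤f (0≤* 0≤n (0≤+ (0≤* (0≤# {11}) n≥10⁴) (0≤# {109994})))))
      (0≤* 0≤m (0≤* (0≤² n) (0≤+ (0≤* (0≤# {3}) n≥10⁴) (0≤# {29996})))))
    (trans (expand (fall n) (f u) ε ρ) (trans (cong (λ s → fall n * (f u + ε) - s) count) (identity n u ε)))
    where
    expand : ∀ D f ε ρ → D * (f + ε - ρ) ≡ D * (f + ε) - ρ * D
    expand = solve 4 (λ D f ε ρ → D :* (f :+ ε :- ρ) := D :* (f :+ ε) :- ρ :* D) refl
    identity : ∀ n u ε →
      (n - # 3) * ((n - # 2) * ((n - # 1) * n)) * (u * (# 1 - u) * (# 1 - # 2 * (u * (# 1 - u))) + ε)
        - (u * n) * ((# 1 - u) * n) * (((u * n) - # 2) * ((u * n) - # 1) + (((# 1 - u) * n) - # 2) * (((# 1 - u) * n) - # 1))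
      ≡ ε * ((n - # 3) * ((n - # 2) * ((n - # 1) * n)) - ½ * (n * n * (n * n)))
        + ½ * (n * n * n * (ε * n - # 2)) + n * n * n * (¼ + # 12 * ((u * (# 1 - u) - ¼) * (u * (# 1 - u) - ¼)))
        + u * (# 1 - u) * (# 1 - # 2 * (u * (# 1 - u))) * (n * (# 11 * (n - # 10000) + # 109994))
        + u * (# 1 - u) * (n * n * (# 3 * (n - # 10000) + # 29996))
    identity = solve 3 (λ n u ε →
      (n :- con (# 3)) :* ((n :- con (# 2)) :* ((n :- con (# 1)) :* n))
          :* (u :* (con (# 1) :- u) :* (con (# 1) :- con (# 2) :* (u :* (con (# 1) :- u))) :+ ε)
        :- (u :* n) :* ((con (# 1) :- u) :* n)
          :* (((u :* n) :- con (# 2)) :* ((u :* n) :- con (# 1))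
            :+ (((con (# 1) :- u) :* n) :- con (# 2)) :* (((con (# 1) :- u) :* n) :- con (# 1)))
      := ε :* ((n :- con (# 3)) :* ((n :- con (# 2)) :* ((n :- con (# 1)) :* n)) :- con ½ :* (n :* n :* (n :* n)))
        :+ con ½ :* (n :* n :* n :* (ε :* n :- con (# 2)))
        :+ n :* n :* n :* (con ¼ :+ con (# 12) :* ((u :* (con (# 1) :- u) :- con ¼) :* (u :* (con (# 1) :- u) :- con ¼)))
        :+ u :* (con (# 1) :- u) :* (con (# 1) :- con (# 2) :* (u :* (con (# 1) :- u))) :* (n :* (con (# 11) :* (n :- con (# 10000)) :+ con (# 109994)))
        :+ u :* (con (# 1) :- u) :* (n :* n :* (con (# 3) :* (n :- con (# 10000)) :+ con (# 29996)))) refl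

  ≤bipartite-density : ∀ ε → 0ℚ ≤ ε → 0ℚ ≤ ε * n - # 2 → f u ≤ ρ + ε
  ≤bipartite-density ε 0≤ε 2≤εn = ≤-by (fall n) _ fall>0
    (0≤+ (0≤+ (0≤+ (main-term ε 0≤ε 2≤εn)
      (0≤* 0≤n³ (0≤+ 0≤¼ (0≤* (0≤# {3}) (0≤² (u - ½))))))
      (0≤* (0≤# {4}) (0≤* 0≤m (0≤² n))))
      (0≤* 0≤f fall≤n⁴))
    (trans (expand (fall n) (f u) ε ρ) (trans (cong (λ s → s + fall n * (ε - f u)) count) (identity n u ε)))
    where
    expand : ∀ D f ε ρ → D * (ρ + ε - f) ≡ ρ * D + D * (ε - f)
    expand = solve 4 (λ D f ε ρ → D :* (ρ :+ ε :- f) := ρ :* D :+ D :* (ε :- f)) refl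
    identity : ∀ n u ε →
      (u * n) * ((# 1 - u) * n) * (((u * n) - # 2) * ((u * n) - # 1) + (((# 1 - u) * n) - # 2) * (((# 1 - u) * n) - # 1))
        + (n - # 3) * ((n - # 2) * ((n - # 1) * n)) * (ε - u * (# 1 - u) * (# 1 - # 2 * (u * (# 1 - u))))
      ≡ ε * ((n - # 3) * ((n - # 2) * ((n - # 1) * n)) - ½ * (n * n * (n * n)))
        + ½ * (n * n * n * (ε * n - # 2)) + n * n * n * (¼ + # 3 * ((u - ½) * (u - ½)))
        + # 4 * (u * (# 1 - u) * (n * n))
        + u * (# 1 - u) * (# 1 - # 2 * (u * (# 1 - u))) * (n * n * (n * n) - (n - # 3) * ((n - # 2) * ((n - # 1) * n)))
    identity = solve 3 (λ n u ε →
      (u :* n) :* ((con (# 1) :- u) :* n)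
          :* (((u :* n) :- con (# 2)) :* ((u :* n) :- con (# 1))
            :+ (((con (# 1) :- u) :* n) :- con (# 2)) :* (((con (# 1) :- u) :* n) :- con (# 1)))
        :+ (n :- con (# 3)) :* ((n :- con (# 2)) :* ((n :- con (# 1)) :* n))
          :* (ε :- u :* (con (# 1) :- u) :* (con (# 1) :- con (# 2) :* (u :* (con (# 1) :- u))))
      := ε :* ((n :- con (# 3)) :* ((n :- con (# 2)) :* ((n :- con (# 1)) :* n)) :- con ½ :* (n :* n :* (n :* n)))
        :+ con ½ :* (n :* n :* n :* (ε :* n :- con (# 2))) :+ n :* n :* n :* (con ¼ :+ con (# 3) :* ((u :- con ½) :* (u :- con ½)))
        :+ con (# 4) :* (u :* (con (# 1) :- u) :* (n :* n))
        :+ u :* (con (# 1) :- u) :* (con (# 1) :- con (# 2) :* (u :* (con (# 1) :- u)))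
          :* (n :* n :* (n :* n) :- (n :- con (# 3)) :* ((n :- con (# 2)) :* ((n :- con (# 1)) :* n)))) refl

-- Absolute values, a Lipschitz bound and the Archimedean property

∣x∣≤ : ∀ {x b} → x ≤ b → - x ≤ b → ∣ x ∣ ≤ b
∣x∣≤ {x} {b} x≤b -x≤b with ∣p∣≡p∨∣p∣≡-p x
... | inj₁ eq = subst (_≤ b) (sym eq) x≤b
... | inj₂ eq = subst (_≤ b) (sym eq) -x≤b

x≤∣x∣ : ∀ x → x ≤ ∣ x ∣
x≤∣x∣ x with ≤-total 0ℚ x
... | inj₁ 0≤x = ≤-reflexive (sym (0≤p⇒∣p∣≡p 0≤x))
... | inj₂ x≤0 = ≤-trans x≤0 (0≤∣p∣ x)

∣-∣-sym : ∀ x y → ∣ x - y ∣ ≡ ∣ y - x ∣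
∣-∣-sym x y = trans (cong ∣_∣ (identity x y)) (∣-p∣≡∣p∣ (y - x))
  where
  identity : ∀ x y → x - y ≡ - (y - x)
  identity = solve 2 (λ x y → x :- y := :- (y :- x)) refl

∣*∣≤ : ∀ {x y a b} → ∣ x ∣ ≤ a → ∣ y ∣ ≤ b → ∣ x * y ∣ ≤ a * b
∣*∣≤ {x} {y} {a} {b} hx hy = subst (_≤ a * b) (sym (∣p*q∣≡∣p∣*∣q∣ x y)) (≤-trans
  (*-monoʳ-≤-nonNeg ∣ y ∣ {{∣-∣-nonNeg y}} hx)
  (*-monoˡ-≤-nonNeg a {{nonNegative (≤-trans (0≤∣p∣ x) hx)}} hy))

∣-∣≤ : ∀ {x y a b} → ∣ x ∣ ≤ a → ∣ y ∣ ≤ b → ∣ x - y ∣ ≤ a + b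
∣-∣≤ {x} {y} hx hy = ≤-trans (∣p-q∣≤∣p∣+∣q∣ x y) (+-mono-≤ hx hy)

-- 343 = 7 · 49: in f u - f v = (u - v) (1 - u - v) (1 - 2u (1 - u) - 2v (1 - v)) the last two
-- factors are at most 4 + 3 and 1 + 24 + 24. The range up to 3 allows for approximations that leave
-- the unit interval.
f-Lipschitz : ∀ u v → ∣ u ∣ ≤ # 3 → ∣ v ∣ ≤ # 3 → ∣ f u - f v ∣ ≤ # 343 * ∣ u - v ∣
f-Lipschitz u v hu hv = subst₂ _≤_ (cong ∣_∣ (sym (identity u v))) (*-comm ∣ u - v ∣ (# 343)) (∣*∣≤ {u - v} ≤-refl slope)
  where
  identity : ∀ u v →
    u * (# 1 - u) * (# 1 - # 2 * (u * (# 1 - u))) - v * (# 1 - v) * (# 1 - # 2 * (v * (# 1 - v)))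
    ≡ (u - v) * ((# 1 - u - v) * (# 1 - # 2 * (u * (# 1 - u)) - # 2 * (v * (# 1 - v))))
  identity = solve 2 (λ u v →
    u :* (con (# 1) :- u) :* (con (# 1) :- con (# 2) :* (u :* (con (# 1) :- u)))
      :- v :* (con (# 1) :- v) :* (con (# 1) :- con (# 2) :* (v :* (con (# 1) :- v)))
    := (u :- v) :* ((con (# 1) :- u :- v)
      :* (con (# 1) :- con (# 2) :* (u :* (con (# 1) :- u)) :- con (# 2) :* (v :* (con (# 1) :- v))))) refl
  1-x : ∀ {x} → ∣ x ∣ ≤ # 3 → ∣ 1ℚ - x ∣ ≤ # 4
  1-x = ∣-∣≤ {1ℚ} ≤-refl
  2m : ∀ {x} → ∣ x ∣ ≤ # 3 → ∣ # 2 * (x * (1ℚ - x)) ∣ ≤ # 24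
  2m {x} hx = ∣*∣≤ {# 2} ≤-refl (∣*∣≤ {x} hx (1-x hx))
  slope : ∣ (1ℚ - u - v) * (1ℚ - # 2 * (u * (1ℚ - u)) - # 2 * (v * (1ℚ - v))) ∣ ≤ # 343
  slope = ∣*∣≤ {1ℚ - u - v} (∣-∣≤ {1ℚ - u} (1-x hu) hv) (∣-∣≤ {1ℚ - # 2 * (u * (1ℚ - u))} (∣-∣≤ {1ℚ} ≤-refl (2m hu)) (2m hv))

1≤↥ : ∀ ε → 0ℚ < ε → 1ℤ ℤ.≤ ↥ ε
1≤↥ ε@(mkℚ i _ _) 0<ε = ℤ.i<j⇒suc[i]≤j (ℤ.positive⁻¹ i {{positive {ε} 0<ε}})

-- ε is at least the reciprocal of its denominator, so k times the denominator serves as the bound.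
archimedean : ∀ k ε → 0ℚ < ε → ∃[ N ] ∀ n → N ℕ.≤ n → 0ℚ ≤ ε * # n - # k
archimedean k ε 0<ε = k ℕ.* ↧ₙ ε , λ n N≤n → subst (0ℚ ≤_)
  (trans (cong (λ i → ε * (# n - # k * # ↧ₙ ε) + # k * (i - 1ℚ)) (sym ε*den)) (identity ε (# n) (# k) (# ↧ₙ ε)))
  (0≤+ (0≤* (<⇒≤ 0<ε) (x≤y⇒0≤y-x (subst (_≤ # n) (trans (cong ι (ℤ.pos-* k (↧ₙ ε))) (ι-* (+ k) (↧ ε))) (ι-mono-≤ (ℤ.+≤+ N≤n)))))
    (0≤* (0≤# {k}) (x≤y⇒0≤y-x (ι-mono-≤ {1ℤ} {↥ ε} (1≤↥ ε 0<ε)))))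
  where
  ε*den : ε * # ↧ₙ ε ≡ ι (↥ ε)
  ε*den = trans (cong (_* # ↧ₙ ε) (sym (↥p/↧p≡p ε))) (/-*-cancel (↥ ε) (↧ₙ ε))
  identity : ∀ ε n k d → ε * (n - k * d) + k * (ε * d - # 1) ≡ ε * n - k
  identity = solve 4 (λ ε n k d → ε :* (n :- k :* d) :+ k :* (ε :* d :- con (# 1)) := ε :* n :- k) refl

∣x-y∣≤b⇒x≤y+b : ∀ x y {b} → ∣ x - y ∣ ≤ b → x ≤ y + b
∣x-y∣≤b⇒x≤y+b x y {b} h = subst (_≤ y + b) (identity x y) (+-monoʳ-≤ y (≤-trans (x≤∣x∣ (x - y)) h))
  where
  identity : ∀ x y → y + (x - y) ≡ x
  identity = solve 2 (λ x y → y :+ (x :- y) := x) refl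

∣x-y∣≤b⇒y≤x+b : ∀ x y {b} → ∣ x - y ∣ ≤ b → y ≤ x + b
∣x-y∣≤b⇒y≤x+b x y {b} h = ∣x-y∣≤b⇒x≤y+b y x (subst (_≤ b) (∣-∣-sym x y) h)

x≤y+b∧y≤x+b⇒∣x-y∣≤b : ∀ x y {b} → x ≤ y + b → y ≤ x + b → ∣ x - y ∣ ≤ b
x≤y+b∧y≤x+b⇒∣x-y∣≤b x y {b} x≤y+b y≤x+b = ∣x∣≤ (drop x≤y+b) (subst (_≤ b) (flip x y) (drop y≤x+b))
  where
  flip : ∀ x y → y - x ≡ - (x - y)
  flip = solve 2 (λ x y → y :- x := :- (x :- y)) refl
  drop : ∀ {x y} → x ≤ y + b → x - y ≤ b
  drop {x} {y} h = 0≤y-x⇒x≤y (subst (0ℚ ≤_) (identity x y b) (x≤y⇒0≤y-x h))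
    where
    identity : ∀ x y b → y + b - x ≡ b - (x - y)
    identity = solve 3 (λ x y b → y :+ b :- x := b :- (x :- y)) refl

≤-+ε : ∀ {x y ε} → 0ℚ < ε → x ≤ y → x ≤ y + ε
≤-+ε {x} {y} {ε} 0<ε x≤y = subst (_≤ y + ε) (+-identityʳ x) (+-mono-≤ x≤y (<⇒≤ 0<ε))

n≥10⁴⇒ : ∀ n → 10000 ℕ.≤ n → 0ℚ ≤ # n - # 10000
n≥10⁴⇒ n h = x≤y⇒0≤y-x (ι-mono-≤ {+ 10000} {+ n} (ℤ.+≤+ h))

4≤10⁴ : 4 ℕ.≤ 10000
4≤10⁴ = ℕ.m≤m+n 4 9996

-- The integer bounds in terms of densities

density*fall : ∀ {n} (G : Graph n) .(4≤n : 4 ℕ.≤ n) → 10000 ℕ.≤ n → density H₀ G 4≤n * fall (# n) ≡ # Λ H₀ G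
density*fall {n} G 4≤n n≥10⁴ = trans (cong (density H₀ G 4≤n *_) (sym (#nP4 n (ℕ.≤-trans 4≤10⁴ n≥10⁴))))
  (/-*-cancel (+ Λ H₀ G) (n P 4) {{nPk≢0 4≤n}})

nearest-bipartiteℚ : ∀ {n} (G : Graph n) .(4≤n : 4 ℕ.≤ n) → 10000 ℕ.≤ n →
  ∃[ c ] # 384 * (density H₀ G 4≤n * fall (# n)) + # n * # n * # editDistance G (blowup K₂ c) ≤ # 48 * (Aℚ (# n) * Aℚ (# n))
nearest-bipartiteℚ {n} G 4≤n n≥10⁴ = from (UpperBound.nearest-bipartite G 0≤n-288)
  where
  0≤n-288 : 0ℤ ℤ.≤ + n ℤ.- + 288
  0≤n-288 = ℤ.i≤j⇒0≤j-i {+ 288} {+ n} (ℤ.+≤+ (ℕ.≤-trans (ℕ.m≤m+n 288 9712) n≥10⁴))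
  N L : ℤ
  N = + n
  L = + Λ H₀ G
  from : (∃[ c ] + 384 ℤ.* L ℤ.+ N ℤ.* N ℤ.* + editDistance G (blowup K₂ c) ℤ.≤ + 48 ℤ.* (A N ℤ.* A N)) →
    ∃[ c ] # 384 * (density H₀ G 4≤n * fall (# n)) + # n * # n * # editDistance G (blowup K₂ c) ≤ # 48 * (Aℚ (# n) * Aℚ (# n))
  from (c , bound) = c , subst₂ _≤_
    (trans (ι-+ (+ 384 ℤ.* L) (N ℤ.* N ℤ.* ed)) (cong₂ _+_
      (trans (ι-* (+ 384) L) (cong (# 384 *_) (sym (density*fall G 4≤n n≥10⁴))))
      (trans (ι-* (N ℤ.* N) ed) (cong (_* ι ed) (ι-* N N)))))
    (trans (ι-* (+ 48) (A N ℤ.* A N)) (cong (# 48 *_) (trans (ι-* (A N) (A N)) (cong₂ _*_ (ι-A N) (ι-A N)))))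
    (ι-mono-≤ {+ 384 ℤ.* L ℤ.+ N ℤ.* N ℤ.* ed} {+ 48 ℤ.* (A N ℤ.* A N)} bound)
    where
    ed : ℤ
    ed = + editDistance G (blowup K₂ c)

nearly-extremalℚ : ∀ n .(4≤n : 4 ℕ.≤ n) → 10000 ℕ.≤ n →
  ∃[ c ] # 96 * (Aℚ (# n) * Aℚ (# n)) ≤ # 768 * (density H₀ (blowup {n = n} K₂ c) 4≤n * fall (# n)) + # n * # n
nearly-extremalℚ n 4≤n n≥10⁴ = from (nearly-extremal n n≥10⁴)
  where
  N : ℤ
  N = + n
  from : (∃[ c ] + 96 ℤ.* (A N ℤ.* A N) ℤ.≤ + 768 ℤ.* + Λ H₀ (blowup {n = n} K₂ c) ℤ.+ N ℤ.* N) →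
    ∃[ c ] # 96 * (Aℚ (# n) * Aℚ (# n)) ≤ # 768 * (density H₀ (blowup {n = n} K₂ c) 4≤n * fall (# n)) + # n * # n
  from (c , bound) = c , subst₂ _≤_
    (trans (ι-* (+ 96) (A N ℤ.* A N)) (cong (# 96 *_) (trans (ι-* (A N) (A N)) (cong₂ _*_ (ι-A N) (ι-A N)))))
    (trans (ι-+ (+ 768 ℤ.* L) (N ℤ.* N)) (cong₂ _+_
      (trans (ι-* (+ 768) L) (cong (# 768 *_) (sym (density*fall (blowup K₂ c) 4≤n n≥10⁴))))
      (ι-* N N)))
    (ι-mono-≤ {+ 96 ℤ.* (A N ℤ.* A N)} {+ 768 ℤ.* L ℤ.+ N ℤ.* N} bound)
    where
    L : ℤ
    L = + Λ H₀ (blowup K₂ c)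

-- The limit 1/8 and perfect stability

maxDensity⟶⅛ : maxDensity H₀ ⟶ fromℚ ⅛
maxDensity⟶⅛ ε 0<ε = 10000 ⊔ proj₁ arch , bounds
  where
  arch : ∃[ N ] ∀ n → N ℕ.≤ n → 0ℚ ≤ ε * # n - # 1
  arch = archimedean 1 ε 0<ε
  bounds : ∀ n .(4≤n : 4 ℕ.≤ n) → 10000 ⊔ proj₁ arch ℕ.≤ n →
    fromℚ (maxDensity H₀ n 4≤n) ≤ᴿ fromℚ ⅛ +ᴿ fromℚ ε × fromℚ ⅛ ≤ᴿ fromℚ (maxDensity H₀ n 4≤n) +ᴿ fromℚ ε
  bounds n 4≤n N≤n = (λ ε′ 0<ε′ → 0 , λ _ _ → ≤-+ε 0<ε′ upper) , (λ ε′ 0<ε′ → 0 , λ _ _ → ≤-+ε 0<ε′ lower)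
    where
    n≥10⁴ : 10000 ℕ.≤ n
    n≥10⁴ = ℕ.≤-trans (ℕ.m≤m⊔n 10000 (proj₁ arch)) N≤n
    1≤εn : 0ℚ ≤ ε * # n - # 1
    1≤εn = proj₂ arch n (ℕ.≤-trans (ℕ.m≤n⊔m 10000 (proj₁ arch)) N≤n)
    open Large (# n) (n≥10⁴⇒ n n≥10⁴)
    -- `maxDensity` is by definition the density of this graph, so the upper bound is applied to the
    -- maximizer itself.
    G : Graph n
    G = ℚ-Extrema.argmax (λ G → density H₀ G 4≤n) (complete n) (graphs n)
    nearest = nearest-bipartiteℚ G 4≤n n≥10⁴
    extremal = nearly-extremalℚ n 4≤n n≥10⁴
    upper : maxDensity H₀ n 4≤n ≤ ⅛ + ε
    upper = density≤ (density H₀ G 4≤n) (# editDistance G (blowup K₂ (proj₁ nearest))) (proj₂ nearest)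
      (0≤# {editDistance G (blowup K₂ (proj₁ nearest))}) ε (<⇒≤ 0<ε) 1≤εn
    lower : ⅛ ≤ maxDensity H₀ n 4≤n + ε
    lower = ≤-trans (⅛≤density (density H₀ (blowup K₂ (proj₁ extremal)) 4≤n) (proj₂ extremal) ε (<⇒≤ 0<ε) 1≤εn)
      (+-monoˡ-≤ ε (density≤maxDensity H₀ (blowup K₂ (proj₁ extremal)) 4≤n))

stable : perfectlyStable H₀ K₂
stable = # 10000 , positive⁻¹ (# 10000) , bound
  where
  bound : ∀ n .(4≤n : 4 ℕ.≤ n) → # 10000 ≤ # n → (G : Graph n) →
    ∃[ c ] # editDistance G (blowup K₂ c) ≤ # 10000 * (maxDensity H₀ n 4≤n - density H₀ G 4≤n) * (# n * # n)
  bound n 4≤n C≤n G = proj₁ nearest ,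
    Large.stability (# n) (n≥10⁴⇒ n n≥10⁴) (density H₀ G 4≤n) (# ed) (proj₂ nearest) (0≤# {ed})
      (density H₀ (blowup K₂ (proj₁ extremal)) 4≤n) (maxDensity H₀ n 4≤n) (proj₂ extremal)
      (density≤maxDensity H₀ (blowup K₂ (proj₁ extremal)) 4≤n) (density≤maxDensity H₀ G 4≤n) (integral ed)
    where
    n≥10⁴ : 10000 ℕ.≤ n
    n≥10⁴ = #-cancel-≤ {10000} {n} C≤n
    nearest = nearest-bipartiteℚ G 4≤n n≥10⁴
    extremal = nearly-extremalℚ n 4≤n n≥10⁴
    ed : ℕ
    ed = editDistance G (blowup K₂ (proj₁ nearest))
    integral : ∀ m → # m ≡ 0ℚ ⊎ # 1 ≤ # m
    integral ℕ.zero = inj₁ refl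
    integral (ℕ.suc m) = inj₂ (ι-mono-≤ {+ 1} {+ ℕ.suc m} (ℤ.+≤+ (ℕ.s≤s z≤n)))

-- Blowup densities and the unique maximizer

module _ (a : Simplex 2) where

  private
    a₀ a₁ : ℕ → ℚ
    a₀ = approx (coord a 0F)
    a₁ = approx (coord a 1F)

  -- With tolerance 1 in the simplex conditions, eventually a₀, a₁ ≥ -1 and a₀ + a₁ ≤ 2, so a₀ lies
  -- between -1 and 3.
  bounded : ∃[ N ] ∀ i → N ℕ.≤ i → ∣ a₀ i ∣ ≤ # 3
  bounded = proj₁ p ⊔ (proj₁ q ⊔ proj₁ s) , λ i i≥ →
    let i≥p = ℕ.≤-trans (ℕ.m≤m⊔n (proj₁ p) (proj₁ q ⊔ proj₁ s)) i≥
        i≥qs = ℕ.≤-trans (ℕ.m≤n⊔m (proj₁ p) (proj₁ q ⊔ proj₁ s)) i≥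
        0≤1+a₀ = x≤y⇒0≤y-x (proj₂ p i i≥p)
        0≤1+a₁ = x≤y⇒0≤y-x (proj₂ q i (ℕ.≤-trans (ℕ.m≤m⊔n (proj₁ q) (proj₁ s)) i≥qs))
        a₀+a₁≤2 = x≤y⇒0≤y-x (proj₂ s i (ℕ.≤-trans (ℕ.m≤n⊔m (proj₁ q) (proj₁ s)) i≥qs))
    in ∣x∣≤ (0≤y-x⇒x≤y (subst (0ℚ ≤_) (above (a₀ i) (a₁ i)) (0≤+ a₀+a₁≤2 0≤1+a₁)))
            (0≤y-x⇒x≤y (subst (0ℚ ≤_) (below (a₀ i)) (0≤+ 0≤1+a₀ (0≤# {2}))))
    where
    p : ∃[ N ] ∀ i → N ℕ.≤ i → 0ℚ ≤ a₀ i + 1ℚ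
    p = nonneg a 0F 1ℚ 0<1
    q : ∃[ N ] ∀ i → N ℕ.≤ i → 0ℚ ≤ a₁ i + 1ℚ
    q = nonneg a 1F 1ℚ 0<1
    s : ∃[ N ] ∀ i → N ℕ.≤ i → a₀ i + (a₁ i + 0ℚ) ≤ 1ℚ + 1ℚ
    s = proj₁ (sum≈1 a) 1ℚ 0<1
    above : ∀ x y →
      # 1 + # 1 - (x + (y + # 0)) + (y + # 1 - # 0)
      ≡ # 3 - x
    above = solve 2 (λ x y →
      con (# 1) :+ con (# 1) :- (x :+ (y :+ con (# 0))) :+ (y :+ con (# 1) :- con (# 0))
      := con (# 3) :- x) refl
    below : ∀ x → x + # 1 - # 0 + # 2 ≡ # 3 - (- x)
    below = solve 1 (λ x → x :+ con (# 1) :- con (# 0) :+ con (# 2) := con (# 3) :- (:- x)) refl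

  -- The limit density as a function of a₀ alone, a₁ being 1 − a₀.
  limitDensity : ℝ
  limitDensity .approx i = f (a₀ i)
  limitDensity .cauchy ε 0<ε = proj₁ bounded ⊔ proj₁ close , λ i j i≥ j≥ →
    let left  = λ {i} (i≥ : proj₁ bounded ⊔ proj₁ close ℕ.≤ i) → ℕ.≤-trans (ℕ.m≤m⊔n (proj₁ bounded) (proj₁ close)) i≥
        right = λ {i} (i≥ : proj₁ bounded ⊔ proj₁ close ℕ.≤ i) → ℕ.≤-trans (ℕ.m≤n⊔m (proj₁ bounded) (proj₁ close)) i≥
    in ≤-<-trans (f-Lipschitz (a₀ i) (a₀ j) (proj₂ bounded i (left i≥)) (proj₂ bounded j (left j≥)))
      (subst (# 343 * ∣ a₀ i - a₀ j ∣ <_) (identity ε) (*-monoʳ-<-pos (# 343) (proj₂ close i j (right i≥) (right j≥))))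
    where
    c : ℚ
    c = + 1 / 343
    close : ∃[ N ] ∀ i j → N ℕ.≤ i → N ℕ.≤ j → ∣ a₀ i - a₀ j ∣ < c * ε
    close = cauchy (coord a 0F) (c * ε) (0<* (positive⁻¹ c) 0<ε)
    identity : ∀ ε → # 343 * (c * ε) ≡ ε
    identity ε = trans (sym (*-assoc (# 343) c ε)) (*-identityˡ ε)

  -- The comparison passes through `f u` for the exact fraction `u` of part `0F`: half of ε covers
  -- the finite order, the other half the distance from `u` to the limit weight.
  limitDensity-correct : IsBlowupDensity H₀ K₂ a limitDensity
  limitDensity-correct c c⟶a ε 0<ε = 10000 ⊔ (proj₁ fractions ⊔ proj₁ arch) , λ n 4≤n N≤n →
    (λ ε′ 0<ε′ → proj₁ (close n 4≤n N≤n) , λ i i≥ → ≤-+ε 0<ε′ (proj₁ (proj₂ (close n 4≤n N≤n) i i≥))) ,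
    (λ ε′ 0<ε′ → proj₁ (close n 4≤n N≤n) , λ i i≥ → ≤-+ε 0<ε′ (proj₂ (proj₂ (close n 4≤n N≤n) i i≥)))
    where
    κ η : ℚ
    -- 1372 = 4 · 343. The limit of the fractions and the comparison of reals each cost η, so u and
    -- a₀ differ by at most 2η, and the Lipschitz constant 343 turns this into ε/2.
    κ = + 1 / 1372
    η = κ * ε
    0<η : 0ℚ < η
    0<η = 0<* (positive⁻¹ κ) 0<ε
    0<½ε : 0ℚ < ½ * ε
    0<½ε = 0<* (positive⁻¹ ½) 0<ε
    343*2η≡½ε : # 343 * (η + η) ≡ ½ * ε
    343*2η≡½ε = trans (cong (# 343 *_) (sym (*-distribʳ-+ ε κ κ))) (sym (*-assoc (# 343) (κ + κ) ε))
    ½ε+½ε≡ε : ½ * ε + ½ * ε ≡ ε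
    ½ε+½ε≡ε = trans (sym (*-distribʳ-+ ε ½ ½)) (*-identityˡ ε)
    fractions = c⟶a 0F η 0<η
    arch = archimedean 2 (½ * ε) 0<½ε

    close : ∀ n .(4≤n : 4 ℕ.≤ n) → 10000 ⊔ (proj₁ fractions ⊔ proj₁ arch) ℕ.≤ n →
      ∃[ N ] ∀ i → N ℕ.≤ i → let ρ = density H₀ (blowup K₂ (c n)) 4≤n in ρ ≤ f (a₀ i) + ε × f (a₀ i) ≤ ρ + ε
    close n 4≤n N≤n = M , λ i i≥ → ρ≤ i i≥ , ≤ρ i i≥
      where
      n≥10⁴ : 10000 ℕ.≤ n
      n≥10⁴ = ℕ.≤-trans (ℕ.m≤m⊔n 10000 (proj₁ fractions ⊔ proj₁ arch)) N≤n
      n≥max : proj₁ fractions ⊔ proj₁ arch ℕ.≤ n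
      n≥max = ℕ.≤-trans (ℕ.m≤n⊔m 10000 (proj₁ fractions ⊔ proj₁ arch)) N≤n
      1≤n : 1 ℕ.≤ n
      1≤n = ℕ.≤-trans (ℕ.s≤s z≤n) n≥10⁴
      open Large (# n) (n≥10⁴⇒ n n≥10⁴)
      open Bipartite (c n) using (Λ-bipartite; p+q≡N)

      p q ρ u : ℚ
      p = # partSize (c n) 0F
      q = # partSize (c n) 1F
      ρ = density H₀ (blowup K₂ (c n)) 4≤n
      u = partFraction (c n) 0F 1≤n

      u*n : u * # n ≡ p
      u*n = /-*-cancel (+ partSize (c n) 0F) n {{ℕ.>-nonZero 1≤n}}
      [1-u]*n : (1ℚ - u) * # n ≡ q
      [1-u]*n = trans (expand u (# n)) (trans (cong₂ _-_ n≡p+q u*n) (cancel p q))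
        where
        expand : ∀ u n → (# 1 - u) * n ≡ n - u * n
        expand = solve 2 (λ u n → (con (# 1) :- u) :* n := n :- u :* n) refl
        cancel : ∀ p q → p + q - p ≡ q
        cancel = solve 2 (λ p q → p :+ q :- p := q) refl
        n≡p+q : # n ≡ p + q
        n≡p+q = trans (sym (cong ι p+q≡N)) (ι-+ (+ partSize (c n) 0F) (+ partSize (c n) 1F))
      0≤u : 0ℚ ≤ u
      0≤u = ≤-by (# n) p n>0 (0≤# {partSize (c n) 0F}) (trans (drop u (# n)) u*n)
        where
        drop : ∀ u n → n * (u - # 0) ≡ u * n
        drop = solve 2 (λ u n → n :* (u :- con (# 0)) := u :* n) refl
      u≤1 : u ≤ 1ℚ
      u≤1 = ≤-by (# n) q n>0 (0≤# {partSize (c n) 1F}) (trans (*-comm (# n) (1ℚ - u)) [1-u]*n)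
      count : ρ * fall (# n) ≡ bipartite-count (u * # n) ((1ℚ - u) * # n)
      count = trans (density*fall (blowup K₂ (c n)) 4≤n n≥10⁴) (trans (cong ι Λ-bipartite)
        (trans (ι-bipartite (+ partSize (c n) 0F) (+ partSize (c n) 1F)) (sym (cong₂ bipartite-count u*n [1-u]*n))))
        where
        ι-pair : ∀ i → ι ((i ℤ.- + 2) ℤ.* (i ℤ.- 1ℤ)) ≡ (ι i - # 2) * (ι i - # 1)
        ι-pair i = trans (ι-* (i ℤ.- + 2) (i ℤ.- 1ℤ)) (cong₂ _*_ (ι-- i (+ 2)) (ι-- i 1ℤ))
        ι-bipartite : ∀ i j → ι (i ℤ.* j ℤ.* ((i ℤ.- + 2) ℤ.* (i ℤ.- 1ℤ) ℤ.+ (j ℤ.- + 2) ℤ.* (j ℤ.- 1ℤ))) ≡ bipartite-count (ι i) (ι j)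
        ι-bipartite i j = trans (ι-* (i ℤ.* j) _) (cong₂ _*_ (ι-* i j)
          (trans (ι-+ ((i ℤ.- + 2) ℤ.* (i ℤ.- 1ℤ)) ((j ℤ.- + 2) ℤ.* (j ℤ.- 1ℤ))) (cong₂ _+_ (ι-pair i) (ι-pair j))))

      2≤½εn : 0ℚ ≤ ½ * ε * # n - # 2
      2≤½εn = proj₂ arch n (ℕ.≤-trans (ℕ.m≤n⊔m (proj₁ fractions) (proj₁ arch)) n≥max)
      u⟶ = proj₂ fractions n 1≤n (ℕ.≤-trans (ℕ.m≤m⊔n (proj₁ fractions) (proj₁ arch)) n≥max)
      above : ∃[ N ] ∀ i → N ℕ.≤ i → u ≤ a₀ i + η + η
      above = proj₁ u⟶ η 0<η
      below : ∃[ N ] ∀ i → N ℕ.≤ i → a₀ i ≤ u + η + η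
      below = proj₂ u⟶ η 0<η
      M : ℕ
      M = proj₁ bounded ⊔ (proj₁ above ⊔ proj₁ below)

      ∣f[u]-f[a]∣≤ : ∀ i → M ℕ.≤ i → ∣ f u - f (a₀ i) ∣ ≤ ½ * ε
      ∣f[u]-f[a]∣≤ i i≥ = ≤-trans (f-Lipschitz u (a₀ i) ∣u∣≤3 (proj₂ bounded i (ℕ.≤-trans (ℕ.m≤m⊔n (proj₁ bounded) _) i≥)))
        (subst (# 343 * ∣ u - a₀ i ∣ ≤_) 343*2η≡½ε (*-monoˡ-≤-nonNeg (# 343) ∣u-a∣≤2η))
        where
        i≥max : proj₁ above ⊔ proj₁ below ℕ.≤ i
        i≥max = ℕ.≤-trans (ℕ.m≤n⊔m (proj₁ bounded) (proj₁ above ⊔ proj₁ below)) i≥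
        ∣u∣≤3 : ∣ u ∣ ≤ # 3
        ∣u∣≤3 = subst (_≤ # 3) (sym (0≤p⇒∣p∣≡p 0≤u)) (≤-trans u≤1 (ι-mono-≤ {+ 1} {+ 3} (ℤ.+≤+ (ℕ.s≤s z≤n))))
        ∣u-a∣≤2η : ∣ u - a₀ i ∣ ≤ η + η
        ∣u-a∣≤2η = x≤y+b∧y≤x+b⇒∣x-y∣≤b u (a₀ i)
          (subst (u ≤_) (+-assoc (a₀ i) η η) (proj₂ above i (ℕ.≤-trans (ℕ.m≤m⊔n (proj₁ above) (proj₁ below)) i≥max)))
          (subst (a₀ i ≤_) (+-assoc u η η) (proj₂ below i (ℕ.≤-trans (ℕ.m≤n⊔m (proj₁ above) (proj₁ below)) i≥max)))

      two-steps : ∀ x y z → x ≤ y + ½ * ε → y ≤ z + ½ * ε → x ≤ z + ε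
      two-steps x y z x≤y y≤z = ≤-trans x≤y (subst (y + ½ * ε ≤_)
        (trans (+-assoc z (½ * ε) (½ * ε)) (cong (λ s → z + s) ½ε+½ε≡ε)) (+-monoˡ-≤ (½ * ε) y≤z))

      ρ≤ : ∀ i → M ℕ.≤ i → ρ ≤ f (a₀ i) + ε
      ρ≤ i i≥ = two-steps ρ (f u) (f (a₀ i))
        (bipartite-density≤ (# n) (n≥10⁴⇒ n n≥10⁴) u ρ 0≤u (x≤y⇒0≤y-x u≤1) count (½ * ε) (<⇒≤ 0<½ε) 2≤½εn)
        (∣x-y∣≤b⇒x≤y+b (f u) (f (a₀ i)) (∣f[u]-f[a]∣≤ i i≥))
      ≤ρ : ∀ i → M ℕ.≤ i → f (a₀ i) ≤ ρ + ε
      ≤ρ i i≥ = two-steps (f (a₀ i)) (f u) ρ (∣x-y∣≤b⇒y≤x+b (f u) (f (a₀ i)) (∣f[u]-f[a]∣≤ i i≥))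
        (≤bipartite-density (# n) (n≥10⁴⇒ n n≥10⁴) u ρ 0≤u (x≤y⇒0≤y-x u≤1) count (½ * ε) (<⇒≤ 0<½ε) 2≤½εn)

  limitDensity≤ : limitDensity ≤ᴿ fromℚ ⅛
  limitDensity≤ ε 0<ε = 0 , λ i _ → ≤-+ε 0<ε (subst (f (a₀ i) ≤_) (sym (f-deficit (a₀ i)))
    (subst (_≤ f (a₀ i) + deficit i) (+-identityʳ (f (a₀ i))) (+-monoʳ-≤ (f (a₀ i)) (0≤* (0≤# {2}) (0≤² ((a₀ i - ½) * (a₀ i - ½)))))))
    where
    deficit : ℕ → ℚ
    deficit i = # 2 * ((a₀ i - ½) * (a₀ i - ½) * ((a₀ i - ½) * (a₀ i - ½)))

  module _ (maximal : fromℚ ⅛ ≤ᴿ limitDensity) where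

    -- As the deficit is 2 (a₀ - 1/2)⁴, maximality is used with tolerance ε⁴. The fourth root is
    -- taken as two square roots.
    a₀-near-½ : ∀ ε → 0ℚ < ε → ∃[ N ] ∀ i → N ℕ.≤ i → ∣ a₀ i - ½ ∣ ≤ ε
    a₀-near-½ ε 0<ε = proj₁ near , λ i i≥ → fourth-root (a₀ i - ½) (deficit≤ (a₀ i) (proj₂ near i i≥))
      where
      ε⁴ : ℚ
      ε⁴ = ε * ε * (ε * ε)
      near : ∃[ N ] ∀ i → N ℕ.≤ i → ⅛ ≤ f (a₀ i) + ε⁴
      near = maximal ε⁴ (0<* (0<* 0<ε 0<ε) (0<* 0<ε 0<ε))
      deficit≤ : ∀ x → ⅛ ≤ f x + ε⁴ → 0ℚ ≤ ε⁴ - # 2 * ((x - ½) * (x - ½) * ((x - ½) * (x - ½)))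
      deficit≤ x h = subst (0ℚ ≤_) (identity (f x) ε⁴ (# 2 * ((x - ½) * (x - ½) * ((x - ½) * (x - ½)))))
        (x≤y⇒0≤y-x (subst (_≤ f x + ε⁴) (f-deficit x) h))
        where
        identity : ∀ f e s → f + e - (f + s) ≡ e - s
        identity = solve 3 (λ f e s → f :+ e :- (f :+ s) := e :- s) refl
      square-root : ∀ {x y} → 0ℚ ≤ x → 0ℚ < y → x * x ≤ y * y → x ≤ y
      square-root {x} {y} 0≤x 0<y h = ≤-by (y + x) _ (+-mono-<-≤ 0<y 0≤x) (x≤y⇒0≤y-x h) (identity x y)
        where
        identity : ∀ x y → (y + x) * (y - x) ≡ y * y - x * x
        identity = solve 2 (λ x y → (y :+ x) :* (y :- x) := y :* y :- x :* x) refl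
      fourth-root : ∀ s → 0ℚ ≤ ε⁴ - # 2 * (s * s * (s * s)) → ∣ s ∣ ≤ ε
      fourth-root s h = square-root (0≤∣p∣ s) 0<ε (subst (_≤ ε * ε) (sym ∣s∣²≡s²)
        (square-root (0≤² s) (0<* 0<ε 0<ε) (0≤y-x⇒x≤y (subst (0ℚ ≤_) (identity ε⁴ (s * s * (s * s))) (0≤+ h (0≤² (s * s)))))))
        where
        ∣s∣²≡s² : ∣ s ∣ * ∣ s ∣ ≡ s * s
        ∣s∣²≡s² = trans (sym (∣p*q∣≡∣p∣*∣q∣ s s)) (0≤p⇒∣p∣≡p (0≤² s))
        identity : ∀ e s → e - # 2 * s + s ≡ e - s
        identity = solve 2 (λ e s → e :- con (# 2) :* s :+ s := e :- s) refl

    a₁-near-½ : ∀ ε → 0ℚ < ε → ∃[ N ] ∀ i → N ℕ.≤ i → ∣ a₁ i - ½ ∣ ≤ ε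
    a₁-near-½ ε 0<ε = proj₁ near ⊔ (proj₁ above ⊔ proj₁ below) , λ i i≥ →
      let i≥max = ℕ.≤-trans (ℕ.m≤n⊔m (proj₁ near) (proj₁ above ⊔ proj₁ below)) i≥
          ∣a₀-½∣≤ = proj₂ near i (ℕ.≤-trans (ℕ.m≤m⊔n (proj₁ near) (proj₁ above ⊔ proj₁ below)) i≥)
          sum≤ = proj₂ above i (ℕ.≤-trans (ℕ.m≤m⊔n (proj₁ above) (proj₁ below)) i≥max)
          ≤sum = proj₂ below i (ℕ.≤-trans (ℕ.m≤n⊔m (proj₁ above) (proj₁ below)) i≥max)
      in x≤y+b∧y≤x+b⇒∣x-y∣≤b (a₁ i) ½
        (0≤y-x⇒x≤y (subst (0ℚ ≤_) (identity₁ (a₀ i) (a₁ i) ε) (0≤+ (x≤y⇒0≤y-x sum≤) (x≤y⇒0≤y-x (∣x-y∣≤b⇒y≤x+b (a₀ i) ½ ∣a₀-½∣≤)))))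
        (0≤y-x⇒x≤y (subst (0ℚ ≤_) (identity₂ (a₀ i) (a₁ i) ε) (0≤+ (x≤y⇒0≤y-x ≤sum) (x≤y⇒0≤y-x (∣x-y∣≤b⇒x≤y+b (a₀ i) ½ ∣a₀-½∣≤)))))
      where
      0<½ε : 0ℚ < ½ * ε
      0<½ε = 0<* (positive⁻¹ ½) 0<ε
      near = a₀-near-½ (½ * ε) 0<½ε
      above : ∃[ N ] ∀ i → N ℕ.≤ i → a₀ i + (a₁ i + 0ℚ) ≤ 1ℚ + ½ * ε
      above = proj₁ (sum≈1 a) (½ * ε) 0<½ε
      below : ∃[ N ] ∀ i → N ℕ.≤ i → 1ℚ ≤ a₀ i + (a₁ i + 0ℚ) + ½ * ε
      below = proj₂ (sum≈1 a) (½ * ε) 0<½ε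
      identity₁ : ∀ x y ε →
        # 1 + ½ * ε - (x + (y + # 0)) + (x + ½ * ε - ½)
        ≡ ½ + ε - y
      identity₁ = solve 3 (λ x y ε →
        con (# 1) :+ con ½ :* ε :- (x :+ (y :+ con (# 0))) :+ (x :+ con ½ :* ε :- con ½)
        := con ½ :+ ε :- y) refl
      identity₂ : ∀ x y ε →
        x + (y + # 0) + ½ * ε - # 1 + (½ + ½ * ε - x)
        ≡ y + ε - ½
      identity₂ = solve 3 (λ x y ε →
        x :+ (y :+ con (# 0)) :+ con ½ :* ε :- con (# 1) :+ (con ½ :+ con ½ :* ε :- x)
        := y :+ ε :- con ½) refl

    coord≈½ : ∀ i → coord a i ≈ fromℚ ½
    coord≈½ i = (λ ε 0<ε → proj₁ (near i ε 0<ε) , λ j j≥ → ∣x-y∣≤b⇒x≤y+b (approx (coord a i) j) ½ (proj₂ (near i ε 0<ε) j j≥)) ,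
                (λ ε 0<ε → proj₁ (near i ε 0<ε) , λ j j≥ → ∣x-y∣≤b⇒y≤x+b (approx (coord a i) j) ½ (proj₂ (near i ε 0<ε) j j≥))
      where
      near : ∀ i ε → 0ℚ < ε → ∃[ N ] ∀ j → N ℕ.≤ j → ∣ approx (coord a i) j - ½ ∣ ≤ ε
      near 0F = a₀-near-½
      near 1F = a₁-near-½

theorem3p11 : (maxDensity H₀ ⟶ fromℚ (+ 1 / 8)) × perfectlyStable H₀ K₂ × uniqueMaximizer H₀ K₂ equalWeights
theorem3p11 = maxDensity⟶⅛ , stable ,
  -- For `equalWeights` the value `f ½` computes to `⅛`, so the bounds against `fromℚ ⅛` apply as
  -- they stand.
  limitDensity , limitDensity-correct , λ a → limitDensity≤ a , λ (_ , maximal) → coord≈½ a maximal
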